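{- Let $2\le s\le s'$ be integers. There is a constant $c=c(s,s')>0$ such that every $K_{s,s'}$-free graph $G$ with average degree $r$ contains a minor with average degree at least $c\,r^{1+\frac{1}{2(s-1)}}$.
   Context: All graphs are finite, simple. $K_{s,s'}$ is the complete bipartite graph with parts of sizes $s$ and $s'$; $G$ is $K_{s,s'}$-free if it has no subgraph isomorphic to $K_{s,s'}$. The average degree of $G$ is $2|E(G)|/|V(G)|$. A graph $\Gamma$ is a minor of $G$ if there are vertex-disjoint connected subgraphs $G_u\subseteq G$, $u\in V(\Gamma)$, with an edge of $G$ between $G_u$ and $G_{u'}$ whenever $uu'\in E(\Gamma)$. -}

module Defs where

open import Data.Nat using (ℕ; zero; suc; _+_)
open import Data.Fin using (Fin; _↑ˡ_; _↑ʳ_)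
open import Data.Bool using (Bool; true; false)
open import Data.Maybe using (Maybe; just)
open import Data.List using (List; map; allFin; filter; length)
open import Data.Nat.ListAction using (sum)
open import Data.Product using (Σ; ∃; ∃-syntax; _×_; _,_)
open import Data.Integer using (+_)
open import Data.Rational using (ℚ; _/_; _*_; 0ℚ; 1ℚ)
open import Relation.Binary.PropositionalEquality using (_≡_)
open import Relation.Nullary using (¬_)
open import Function.Definitions using (Injective)

record Graph : Set where
  field
    n     : ℕ
    adj   : Fin n → Fin n → Bool
    sym   : ∀ i j → adj i j ≡ adj j i
    irrefl : ∀ i → adj i i ≡ false
open Graph public

degree : (G : Graph) → Fin (n G) → ℕ
degree G i = length (filter (λ j → Data.Bool._≟_ (adj G i j) true) (allFin (n G)))

degSum : Graph → ℕ
degSum G = sum (map (degree G) (allFin (n G)))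

-- average degree 2|E|/|V| (only meaningful when |V| ≥ 1; set to 0 otherwise)
avgDeg : Graph → ℚ
avgDeg G with n G
... | zero  = 0ℚ
... | suc k = (+ degSum G) / suc k

_^ℚ_ : ℚ → ℕ → ℚ
q ^ℚ zero  = 1ℚ
q ^ℚ suc k = q * (q ^ℚ k)

ContainsK : ℕ → ℕ → Graph → Set
ContainsK s s' G =
  Σ (Fin (s + s') → Fin (n G)) λ h →
    Injective _≡_ _≡_ h ×
    (∀ (i : Fin s) (j : Fin s') → adj G (h (i ↑ˡ s')) (h (s ↑ʳ j)) ≡ true)

KFree : ℕ → ℕ → Graph → Set
KFree s s' G = ¬ ContainsK s s' G

data WalkIn (G : Graph) (P : Fin (n G) → Set) : Fin (n G) → Fin (n G) → Set where
  here : ∀ {x} → P x → WalkIn G P x x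
  step : ∀ {x z y} → P x → adj G x z ≡ true → WalkIn G P z y → WalkIn G P x y

-- Γ is a minor of G: branch sets G_u (u ∈ V(Γ)) given by a partial assignment
-- β : V(G) → Maybe V(Γ) (so branch sets are vertex-disjoint); each branch set is
-- nonempty and induces a connected subgraph of G; for every edge uu' of Γ there
-- is an edge of G between G_u and G_{u'}.
IsMinor : Graph → Graph → Set
IsMinor Γ G =
  Σ (Fin (n G) → Maybe (Fin (n Γ))) λ β →
    (∀ u → ∃[ x ] β x ≡ just u) ×
    (∀ u x y → β x ≡ just u → β y ≡ just u → WalkIn G (λ z → β z ≡ just u) x y) ×
    (∀ u u' → adj Γ u u' ≡ true →
       ∃[ x ] ∃[ y ] (β x ≡ just u × β y ≡ just u' × adj G x y ≡ true))

{-# OPTIONS --safe #-}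
module Submission where

-- Write k = s − 1 and let b be about r^(1/2k).  Pass to a bipartite subgraph with
-- parts X, Y, |X| ≤ |Y|, in which every y ∈ Y has exactly d ≈ r neighbours, all in X.
--
-- (1) Greedily choose disjoint stars ("bags") with centre in Y and at most 8b leaves in
-- X, such that the leaves of each bag together see at least b·d vertices of Y and
-- at least half of the edges at the leaves go to distinct vertices.  A bag centred at
-- y can only get stuck if many x ∈ N(y) send half their edges to a set of b·d
-- vertices; the Kővári–Sós–Turán count for K_{s,s'} with y on the s-side forbids this.
-- A maximal family of bags absorbs a positive proportion of all edges, using only
-- |Y|/b centres.
--
-- (2) Each remaining y ∈ Y seeing many bags is contracted into one of them, L, chosen
-- so that at most about half of the other bags seen by y are already joined to L.
-- If this is impossible for many y, then the leaves z of the bags that are not yet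
-- saturated (joined to c·b·d others) have many neighbours y each of which sees many
-- leaves of the bags joined to the bag of z, and as b^(2k) ≤ r this is again excluded
-- by the K_{s,s'}-count.  Saturated bags could a priori carry most edges; passing to
-- them does not decrease the number of edges per bag, so after finitely many rounds
-- the bags form a minor whose average degree is at least a constant times b·d.

open import Defs
import Data.Bool as Bool
open import Data.Bool using (Bool; true; false; _∧_; _∨_; _xor_; not; if_then_else_)
open import Data.Bool.Properties using (xor-comm; ∨-comm; not-involutive; ∧-zeroʳ; ∧-identityʳ)
open import Data.Empty using (⊥-elim)
import Data.Fin as Fin
open import Data.Fin using (Fin; zero; suc; splitAt; inject≤; _↑ˡ_; _↑ʳ_)
import Data.Fin.Properties as Finₚ
import Data.Integer as ℤ
open import Data.Integer using () renaming (+_ to pos)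
import Data.Integer.Properties as ℤₚ
import Data.List as List using (length; filter; tabulate; map)
open import Data.Maybe using (Maybe; just; nothing; is-just)
open import Data.Maybe.Properties using (just-injective)
open import Data.Nat using (ℕ; zero; suc; _+_; _*_; _^_; _∸_; _≤_; _<_; z≤n; s≤s; s≤s⁻¹; NonZero; >-nonZero; _≤?_; _<?_)
open import Data.Nat.DivMod using (_/_; _%_; m/n*n≤m; m≡m%n+[m/n]*n; m%n<n)
open import Data.Nat.Induction using (<-wellFounded)
import Data.Nat.ListAction as List using (sum)
open import Data.Nat.Properties
open import Data.Nat.Tactic.RingSolver using (solve-∀)
open import Data.Product using (Σ; ∃; _×_; _,_; proj₁; proj₂)
open import Data.Rational using (ℚ; 0ℚ; 1ℚ) renaming (_≤_ to _≤ℚ_; _<_ to _<ℚ_; _*_ to _*ℚ_; _/_ to _/ℚ_; NonNegative to NonNegativeℚ)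
import Data.Rational.Properties as ℚₚ
open import Data.Rational.Unnormalised using (mkℚᵘ; *≤*; *≡*)
import Data.Rational.Unnormalised.Properties as ℚᵘₚ
open import Data.Sum using (_⊎_; inj₁; inj₂)
open import Data.Vec.Functional using (_∷_)
open import Function using (_∘_)
open import Function.Definitions using (Injective)
open import Induction.WellFounded using (Acc; acc)
open import Relation.Binary.PropositionalEquality using (_≡_; _≢_; refl; trans; cong; cong₂; subst; module ≡-Reasoning) renaming (sym to ≡-sym)
open import Relation.Nullary using (¬_; Dec; yes; no)
open import Relation.Nullary.Decidable using (⌊_⌋)
open import Algebra.Properties.Semiring.Sum +-*-semiring as Sum using ()

-- Booleans

∧-intro : ∀ {a b} → a ≡ true → b ≡ true → a ∧ b ≡ true
∧-intro refl refl = refl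

∧-elimˡ : ∀ {a b} → a ∧ b ≡ true → a ≡ true
∧-elimˡ {true} _ = refl

∧-elimʳ : ∀ {a b} → a ∧ b ≡ true → b ≡ true
∧-elimʳ {true} p = p

∨-introˡ : ∀ {a b} → a ≡ true → a ∨ b ≡ true
∨-introˡ refl = refl

∨-introʳ : ∀ {a b} → b ≡ true → a ∨ b ≡ true
∨-introʳ {true} _ = refl
∨-introʳ {false} p = p

∨-elim : ∀ {a b} → a ∨ b ≡ true → a ≡ true ⊎ b ≡ true
∨-elim {true} _ = inj₁ refl
∨-elim {false} p = inj₂ p

not-true : ∀ {a} → not a ≡ true → a ≡ false
not-true {false} _ = refl

not-false : ∀ {a} → a ≡ false → not a ≡ true
not-false refl = refl

true≢false : ∀ {a} {A : Set} → a ≡ true → a ≡ false → A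
true≢false refl ()

bool : ∀ a → a ≡ true ⊎ a ≡ false
bool true = inj₁ refl
bool false = inj₂ refl

¬true : ∀ {a} → ¬ (a ≡ true) → a ≡ false
¬true {true} h = ⊥-elim (h refl)
¬true {false} _ = refl

dec-true : ∀ {P : Set} (d : Dec P) → P → ⌊ d ⌋ ≡ true
dec-true (yes _) _ = refl
dec-true (no ¬p) p = ⊥-elim (¬p p)

true-dec : ∀ {P : Set} (d : Dec P) → ⌊ d ⌋ ≡ true → P
true-dec (yes p) _ = p

false-dec : ∀ {P : Set} (d : Dec P) → ⌊ d ⌋ ≡ false → ¬ P
false-dec (no ¬p) _ = ¬p

_==_ : ∀ {n} → Fin n → Fin n → Bool
i == j = ⌊ i Fin.≟ j ⌋

==-refl : ∀ {n} (i : Fin n) → (i == i) ≡ true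
==-refl i = dec-true (i Fin.≟ i) refl

==-≡ : ∀ {n} {i j : Fin n} → (i == j) ≡ true → i ≡ j
==-≡ {i = i} {j} = true-dec (i Fin.≟ j)

==-≢ : ∀ {n} {i j : Fin n} → (i == j) ≡ false → i ≢ j
==-≢ {i = i} {j} = false-dec (i Fin.≟ j)

infix 4 _≤ᵈ_ _==_

opaque
  _≤ᵈ_ : ℕ → ℕ → Bool
  a ≤ᵈ b = ⌊ a ≤? b ⌋

  ≤ᵈ-true : ∀ {a b} → (a ≤ᵈ b) ≡ true → a ≤ b
  ≤ᵈ-true {a} {b} = true-dec (a ≤? b)

  ≤ᵈ-intro : ∀ {a b} → a ≤ b → (a ≤ᵈ b) ≡ true
  ≤ᵈ-intro {a} {b} = dec-true (a ≤? b)

  ≤ᵈ-false : ∀ {a b} → (a ≤ᵈ b) ≡ false → b < a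
  ≤ᵈ-false {a} {b} p = ≰⇒> (false-dec (a ≤? b) p)

anyᵇ : ∀ {n} → (Fin n → Bool) → Bool
anyᵇ {zero} p = false
anyᵇ {suc n} p = p zero ∨ anyᵇ (p ∘ suc)

any-intro : ∀ {n} (p : Fin n → Bool) i → p i ≡ true → anyᵇ p ≡ true
any-intro p zero h = ∨-introˡ h
any-intro p (suc i) h = ∨-introʳ {p zero} (any-intro (p ∘ suc) i h)

any-elim : ∀ {n} (p : Fin n → Bool) → anyᵇ p ≡ true → ∃ λ i → p i ≡ true
any-elim {suc n} p h with ∨-elim {p zero} h
... | inj₁ q = zero , q
... | inj₂ q with any-elim (p ∘ suc) q
... | i , r = suc i , r

search : ∀ {n} (p : Fin n → Bool) → (∃ λ i → p i ≡ true) ⊎ (∀ i → p i ≡ false)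
search p with bool (anyᵇ p)
... | inj₁ q = inj₁ (any-elim p q)
... | inj₂ q = inj₂ λ i → ¬true λ r → true≢false (any-intro p i r) q

-- Inequalities

-- Linear arithmetic by certificate: the equation exhibits  B − A  as a nonnegative combination of slacks.
linarith : ∀ {A B l r} e → l ≤ r → A + r + e ≡ B + l → A ≤ B
linarith {A} {B} {l} {r} e h eq = +-cancelʳ-≤ r A B (begin
  A + r ≤⟨ m≤m+n (A + r) e ⟩
  A + r + e ≡⟨ eq ⟩
  B + l ≤⟨ +-monoʳ-≤ B h ⟩
  B + r ∎)
  where open ≤-Reasoning

-- Drives every greedy process below: a state either yields the goal or a state of smaller measure,
-- and `_<_` is well-founded.
descent : {S : Set} {P : Set} (f : S → ℕ) → (∀ x → P ⊎ (∃ λ y → f y < f x)) → S → P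
descent {S} {P} f next x₀ = go x₀ (<-wellFounded (f x₀))
  where
  go : ∀ x → Acc _<_ (f x) → P
  go x (acc rs) with next x
  ... | inj₁ p = p
  ... | inj₂ (y , lt) = go y (rs lt)

-- Finite sums

-- Opaque, so that unification recovers the summand from the value of a sum.
opaque
  sum : ∀ {n} → (Fin n → ℕ) → ℕ
  sum = Sum.sum

  sum-suc : ∀ {n} (f : Fin (suc n) → ℕ) → sum f ≡ f zero + sum (f ∘ suc)
  sum-suc f = refl

  sum-cong : ∀ {n} {f g : Fin n → ℕ} → (∀ i → f i ≡ g i) → sum f ≡ sum g
  sum-cong = Sum.sum-cong-≗

  sum-+ : ∀ {n} (f g : Fin n → ℕ) → sum (λ i → f i + g i) ≡ sum f + sum g
  sum-+ = Sum.∑-distrib-+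

  sum-comm : ∀ {m n} (f : Fin m → Fin n → ℕ) → sum (λ i → sum (f i)) ≡ sum (λ j → sum (λ i → f i j))
  sum-comm = Sum.∑-comm

  *-distribˡ-sum : ∀ {n} c (f : Fin n → ℕ) → c * sum f ≡ sum (λ i → c * f i)
  *-distribˡ-sum = Sum.*-distribˡ-sum

  *-distribʳ-sum : ∀ {n} c (f : Fin n → ℕ) → sum f * c ≡ sum (λ i → f i * c)
  *-distribʳ-sum = Sum.*-distribʳ-sum

  sum-mono : ∀ {n} {f g : Fin n → ℕ} → (∀ i → f i ≤ g i) → sum f ≤ sum g
  sum-mono {zero} h = z≤n
  sum-mono {suc n} h = +-mono-≤ (h zero) (sum-mono (h ∘ suc))

  sum-const : ∀ n c → sum {n} (λ _ → c) ≡ n * c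
  sum-const zero c = refl
  sum-const (suc n) c = cong (c +_) (sum-const n c)

  term≤sum : ∀ {n} (f : Fin n → ℕ) i → f i ≤ sum f
  term≤sum f zero = m≤m+n _ _
  term≤sum f (suc i) = ≤-trans (term≤sum (f ∘ suc) i) (m≤n+m _ (f zero))

sum-+₃ : ∀ {n} (f g h : Fin n → ℕ) → sum (λ i → f i + (g i + h i)) ≡ sum f + (sum g + sum h)
sum-+₃ f g h = trans (sum-+ f (λ i → g i + h i)) (cong (sum f +_) (sum-+ g h))

sum-zero : ∀ {n} {f : Fin n → ℕ} → (∀ i → f i ≡ 0) → sum f ≡ 0
sum-zero {n} h = trans (sum-cong h) (trans (sum-const n 0) (*-zeroʳ n))

sum-<-witness : ∀ {n} (f g : Fin n → ℕ) → sum f < sum g → ∃ λ i → f i < g i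
sum-<-witness f g lt with search (λ i → ⌊ f i <? g i ⌋)
... | inj₁ (i , p) = i , true-dec (f i <? g i) p
... | inj₂ q = ⊥-elim (<⇒≱ lt (sum-mono λ i → ≮⇒≥ (false-dec (f i <? g i) (q i))))

[_] : Bool → ℕ
[ true ] = 1
[ false ] = 0

#_ : ∀ {n} → (Fin n → Bool) → ℕ
# p = sum (λ i → [ p i ])

infix 9 #_

[]≤1 : ∀ b → [ b ] ≤ 1
[]≤1 true = ≤-refl
[]≤1 false = z≤n

[]-intro : ∀ {b} → b ≡ true → 1 ≤ [ b ]
[]-intro refl = ≤-refl

[]≤ : ∀ b {x} → (b ≡ true → 1 ≤ x) → [ b ] ≤ x
[]≤ true h = h refl
[]≤ false h = z≤n

[]-mono : ∀ {a b} → (a ≡ true → b ≡ true) → [ a ] ≤ [ b ]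
[]-mono {a} h = []≤ a λ p → []-intro (h p)

[]*≤ : ∀ b {x y} → (b ≡ true → x ≤ y) → [ b ] * x ≤ y
[]*≤ true {x} h = ≤-trans (≤-reflexive (+-identityʳ x)) (h refl)
[]*≤ false h = z≤n

≤[]* : ∀ {b x} → b ≡ true → x ≤ [ b ] * x
≤[]* {x = x} refl = ≤-reflexive (≡-sym (+-identityʳ x))

[]*-monoʳ : ∀ b {x y} → (b ≡ true → x ≤ y) → [ b ] * x ≤ [ b ] * y
[]*-monoʳ true h = +-monoˡ-≤ 0 (h refl)
[]*-monoʳ false h = z≤n

[∧] : ∀ a b → [ a ∧ b ] ≡ [ a ] * [ b ]
[∧] true b = ≡-sym (+-identityʳ [ b ])
[∧] false b = refl

#-mono : ∀ {n} {p q : Fin n → Bool} → (∀ i → p i ≡ true → q i ≡ true) → # p ≤ # q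
#-mono h = sum-mono λ i → []-mono (h i)

#≤n : ∀ {n} (p : Fin n → Bool) → # p ≤ n
#≤n {n} p = ≤-trans (sum-mono λ i → []≤1 (p i)) (≤-reflexive (trans (sum-const n 1) (*-identityʳ n)))

sum-[]* : ∀ {n} (p : Fin n → Bool) c → sum (λ i → [ p i ] * c) ≡ # p * c
sum-[]* p c = ≡-sym (*-distribʳ-sum c (λ i → [ p i ]))

sum-singleton : ∀ {n} (j : Fin n) (f : Fin n → ℕ) → sum (λ i → [ i == j ] * f i) ≡ f j
sum-singleton zero f = trans (sum-suc _) (trans (cong₂ _+_ (+-identityʳ (f zero)) (sum-zero λ i → refl)) (+-identityʳ (f zero)))
sum-singleton (suc j) f = trans (sum-suc _) (trans (sum-cong λ i → cong (λ b → [ b ] * f (suc i)) (shift i)) (sum-singleton j (f ∘ suc)))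
  where
  shift : ∀ i → (suc i == suc j) ≡ (i == j)
  shift i with i Fin.≟ j
  ... | yes _ = refl
  ... | no _ = refl

#-singleton : ∀ {n} (j : Fin n) → # (λ i → i == j) ≡ 1
#-singleton j = trans (sum-cong λ i → ≡-sym (*-identityʳ [ i == j ])) (sum-singleton j (λ _ → 1))

insert : ∀ {n} → Fin n → (Fin n → Bool) → Fin n → Bool
insert j p i = (i == j) ∨ p i

sum-insert : ∀ {n} (p : Fin n → Bool) j (f : Fin n → ℕ) → p j ≡ false →
  sum (λ i → [ insert j p i ] * f i) ≡ f j + sum (λ i → [ p i ] * f i)
sum-insert p j f pj = trans (sum-cong pointwise) (trans (sum-+ (λ i → [ i == j ] * f i) (λ i → [ p i ] * f i)) (cong (_+ _) (sum-singleton j f)))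
  where
  pointwise : ∀ i → [ insert j p i ] * f i ≡ [ i == j ] * f i + [ p i ] * f i
  pointwise i with i Fin.≟ j
  ... | no _ = refl
  ... | yes refl rewrite pj = ≡-sym (+-identityʳ _)

#-insert : ∀ {n} (p : Fin n → Bool) j → p j ≡ false → # (insert j p) ≡ suc (# p)
#-insert p j pj = trans (sum-cong λ i → ≡-sym (*-identityʳ [ insert j p i ])) (trans (sum-insert p j (λ _ → 1) pj)
  (cong suc (sum-cong λ i → *-identityʳ [ p i ])))

remove : ∀ {n} → Fin n → (Fin n → Bool) → Fin n → Bool
remove j p i = p i ∧ not (i == j)

#-remove≥ : ∀ {n} (p : Fin n → Bool) j → # p ≤ suc (# remove j p)
#-remove≥ p j = ≤-trans (sum-mono pointwise) (≤-reflexive (trans (sum-+ (λ i → [ i == j ]) (λ i → [ remove j p i ])) (cong (_+ # remove j p) (#-singleton j))))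
  where
  pointwise : ∀ i → [ p i ] ≤ [ i == j ] + [ remove j p i ]
  pointwise i with i Fin.≟ j
  ... | yes _ = ≤-trans ([]≤1 (p i)) (m≤m+n 1 _)
  ... | no _ with p i
  ... | true = ≤-refl
  ... | false = z≤n

#-remove≤ : ∀ {n} (p : Fin n → Bool) j → # remove j p ≤ # p
#-remove≤ p j = #-mono λ i → ∧-elimˡ

any≤# : ∀ {n} (p : Fin n → Bool) → [ anyᵇ p ] ≤ # p
any≤# p = []≤ (anyᵇ p) λ h → let i , q = any-elim p h in ≤-trans ([]-intro q) (term≤sum _ i)

-- Turns disjointness of bags into a count: a vertex is a leaf of at most one bag, so sums over bags
-- carry no multiplicity.
unique⇒#≤ : ∀ {n} (p : Fin n → Bool) {b} → (∀ i → p i ≡ true → b ≡ true) →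
  (∀ i j → p i ≡ true → p j ≡ true → i ≡ j) → # p ≤ [ b ]
unique⇒#≤ p {b} imp uniq with search p
... | inj₁ (i , pi) = ≤-trans (≤-trans (#-mono λ j pj → trans (cong (_== i) (uniq j i pj pi)) (==-refl i)) (≤-reflexive (#-singleton i))) ([]-intro (imp i pi))
... | inj₂ q = ≤-trans (≤-reflexive (sum-zero λ i → cong [_] (q i))) z≤n

double-count : ∀ {n m} (p : Fin n → Bool) (q : Fin n → Fin m → Bool) →
  sum (λ i → [ p i ] * # q i) ≡ sum (λ j → # (λ i → p i ∧ q i j))
double-count p q = trans (sum-cong λ i → *-distribˡ-sum [ p i ] (λ j → [ q i j ]))
  (trans (sum-comm (λ i j → [ p i ] * [ q i j ])) (sum-cong λ j → sum-cong λ i → ≡-sym ([∧] (p i) (q i j))))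

-- Enumeration of a subset

-- The test is a separate argument, so that proofs can match on it without abstracting `p zero` from
-- the type of indices.
enum-step : ∀ {k n} (b : Bool) → (Fin k → Fin n) → Fin ([ b ] + k) → Fin (suc n)
enum-step true r zero = zero
enum-step true r (suc i) = suc (r i)
enum-step false r i = suc (r i)

opaque
  unfolding sum

  enum : ∀ {n} (p : Fin n → Bool) → Fin (# p) → Fin n
  enum {suc n} p = enum-step (p zero) (enum (p ∘ suc))

  enum-true : ∀ {n} (p : Fin n → Bool) u → p (enum p u) ≡ true
  enum-true {suc n} p u = go (p zero) refl u
    where
    go : ∀ b → p zero ≡ b → (u : Fin ([ b ] + # (p ∘ suc))) → p (enum-step b (enum (p ∘ suc)) u) ≡ true
    go true eq zero = eq
    go true eq (suc i) = enum-true (p ∘ suc) i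
    go false eq i = enum-true (p ∘ suc) i

  enum-injective : ∀ {n} (p : Fin n → Bool) → Injective _≡_ _≡_ (enum p)
  enum-injective {suc n} p {u} {v} = go (p zero) u v
    where
    go : ∀ b (u v : Fin ([ b ] + # (p ∘ suc))) → enum-step b (enum (p ∘ suc)) u ≡ enum-step b (enum (p ∘ suc)) v → u ≡ v
    go true zero zero _ = refl
    go true (suc u) (suc v) eq = cong suc (enum-injective (p ∘ suc) (Finₚ.suc-injective eq))
    go false u v eq = enum-injective (p ∘ suc) (Finₚ.suc-injective eq)

  enum-surjective : ∀ {n} (p : Fin n → Bool) i → p i ≡ true → ∃ λ u → enum p u ≡ i
  enum-surjective {suc n} p zero h = go (p zero) h
    where
    go : ∀ b → b ≡ true → ∃ λ (u : Fin ([ b ] + # (p ∘ suc))) → enum-step b (enum (p ∘ suc)) u ≡ zero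
    go true _ = zero , refl
  enum-surjective {suc n} p (suc i) h with enum-surjective (p ∘ suc) i h
  ... | u , eq = go (p zero)
    where
    go : ∀ b → ∃ λ (u : Fin ([ b ] + # (p ∘ suc))) → enum-step b (enum (p ∘ suc)) u ≡ suc i
    go true = suc u , cong suc eq
    go false = u , cong suc eq

  sum-enum : ∀ {n} (p : Fin n → Bool) (f : Fin n → ℕ) → sum (f ∘ enum p) ≡ sum (λ i → [ p i ] * f i)
  sum-enum {zero} p f = refl
  sum-enum {suc n} p f = go (p zero)
    where
    go : ∀ b → sum (f ∘ enum-step b (enum (p ∘ suc))) ≡ [ b ] * f zero + sum (λ i → [ p (suc i) ] * f (suc i))
    go true = cong₂ _+_ (≡-sym (+-identityʳ (f zero))) (sum-enum (p ∘ suc) (f ∘ suc))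
    go false = sum-enum (p ∘ suc) (f ∘ suc)

  trim : ∀ {n} (p : Fin n → Bool) d → d ≤ # p → Σ (Fin n → Bool) λ q → (∀ i → q i ≡ true → p i ≡ true) × # q ≡ d
  trim {zero} p zero le = p , (λ i h → h) , refl
  trim {suc n} p d le = go (p zero) d refl le
    where
    go : ∀ b d → p zero ≡ b → d ≤ [ b ] + # (p ∘ suc) → Σ (Fin (suc n) → Bool) λ q → (∀ i → q i ≡ true → p i ≡ true) × # q ≡ d
    go true zero eq le = (λ _ → false) , (λ i ()) , sum-zero {suc n} λ _ → refl
    go true (suc d) eq (s≤s le) with trim (p ∘ suc) d le
    ... | q , sub , c = (λ { zero → true ; (suc i) → q i }) , (λ { zero _ → eq ; (suc i) → sub i }) , cong suc c
    go false d eq le with trim (p ∘ suc) d le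
    ... | q , sub , c = (λ { zero → false ; (suc i) → q i }) , (λ { zero () ; (suc i) → sub i }) , c

-- The Kővári–Sós–Turán count

∷-injective : ∀ {n k} {x : Fin n} {v : Fin k → Fin n} → Injective _≡_ _≡_ v → (∀ i → v i ≢ x) → Injective _≡_ _≡_ (x ∷ v)
∷-injective inj x∉v {zero} {zero} _ = refl
∷-injective inj x∉v {zero} {suc j} eq = ⊥-elim (x∉v j (≡-sym eq))
∷-injective inj x∉v {suc i} {zero} eq = ⊥-elim (x∉v i eq)
∷-injective inj x∉v {suc i} {suc j} eq = cong suc (inj eq)

-- Induction on `k`: double counting pairs `(a , w)` yields a `w` whose neighbours in `A` satisfy
-- the same inequality with one power less. Removing `w` from `W` keeps the tuple injective and
-- costs each degree one, which the `k` in `M + k` pays for.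
popular-tuple : ∀ {n} k (q : Fin n → Fin n → Bool) s' M (A W : Fin n → Bool) →
  (∀ a → A a ≡ true → M + k ≤ # (λ w → W w ∧ q a w)) → s' * (# W) ^ k < # A * M ^ k →
  Σ (Fin k → Fin n) λ w → Injective _≡_ _≡_ w × (∀ i → W (w i) ≡ true) ×
    Σ (Fin n → Bool) λ B → s' < # B × (∀ a → B a ≡ true → A a ≡ true) × (∀ a i → B a ≡ true → q a (w i) ≡ true)
popular-tuple zero q s' M A W deg big =
  (λ ()) , (λ {}) , (λ ()) , A , subst (s' <_) (*-identityʳ (# A)) (subst (_< # A * 1) (*-identityʳ s') big) , (λ _ h → h) , λ _ ()
popular-tuple {n} (suc k) q s' M A W deg big = extend (sum-<-witness _ _ lt)
  where
  open ≤-Reasoning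
  Aʷ : Fin n → Fin n → Bool
  Aʷ w a = A a ∧ q a w
  count : sum (λ a → [ A a ] * # (λ w → W w ∧ q a w)) ≡ sum (λ w → [ W w ] * # Aʷ w)
  count = trans (double-count A (λ a w → W w ∧ q a w)) (sum-cong λ w →
    trans (sum-cong λ a → trans (cong [_] (swap (A a) (W w) (q a w))) ([∧] (W w) (Aʷ w a))) (≡-sym (*-distribˡ-sum [ W w ] (λ a → [ Aʷ w a ]))))
    where
    swap : ∀ a b c → a ∧ (b ∧ c) ≡ b ∧ (a ∧ c)
    swap true b c = refl
    swap false true c = refl
    swap false false c = refl
  -- The indicator `[ W w ]` stays on both sides, so that a `w` with strict inequality automatically
  -- lies in `W`.
  lt : sum (λ w → [ W w ] * (s' * # W ^ k)) < sum (λ w → [ W w ] * # Aʷ w * M ^ k)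
  lt = begin-strict
    sum (λ w → [ W w ] * (s' * # W ^ k)) ≡⟨ sum-[]* W (s' * # W ^ k) ⟩
    # W * (s' * # W ^ k) ≡⟨ perm (# W) s' (# W ^ k) ⟩
    s' * (# W * # W ^ k) <⟨ big ⟩
    # A * (M * M ^ k) ≡⟨ *-assoc (# A) M (M ^ k) ⟨
    # A * M * M ^ k ≤⟨ *-monoˡ-≤ (M ^ k) (*-monoʳ-≤ (# A) (m≤m+n M (suc k))) ⟩
    # A * (M + suc k) * M ^ k ≡⟨ cong (_* M ^ k) (sum-[]* A (M + suc k)) ⟨
    sum (λ a → [ A a ] * (M + suc k)) * M ^ k ≤⟨ *-monoˡ-≤ (M ^ k) (sum-mono λ a → []*-monoʳ (A a) (deg a)) ⟩
    sum (λ a → [ A a ] * # (λ w → W w ∧ q a w)) * M ^ k ≡⟨ cong (_* M ^ k) count ⟩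
    sum (λ w → [ W w ] * # Aʷ w) * M ^ k ≡⟨ *-distribʳ-sum (M ^ k) (λ w → [ W w ] * # Aʷ w) ⟩
    sum (λ w → [ W w ] * # Aʷ w * M ^ k) ∎
    where
    perm : ∀ a b c → a * (b * c) ≡ b * (a * c)
    perm = solve-∀
  extend : (∃ λ w → [ W w ] * (s' * # W ^ k) < [ W w ] * # Aʷ w * M ^ k) → Σ (Fin (suc k) → Fin n) λ w → Injective _≡_ _≡_ w × (∀ i → W (w i) ≡ true) ×
    Σ (Fin n → Bool) λ B → s' < # B × (∀ a → B a ≡ true → A a ≡ true) × (∀ a i → B a ≡ true → q a (w i) ≡ true)
  extend (w , h) with W w in Ww
  ... | true with popular-tuple k q s' M (Aʷ w) (remove w W) deg′ big′
    where
    deg′ : ∀ a → Aʷ w a ≡ true → M + k ≤ # (λ v → remove w W v ∧ q a v)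
    deg′ a h′ = s≤s⁻¹ (begin
      suc (M + k) ≡⟨ +-suc M k ⟨
      M + suc k ≤⟨ deg a (∧-elimˡ h′) ⟩
      # (λ v → W v ∧ q a v) ≤⟨ #-remove≥ (λ v → W v ∧ q a v) w ⟩
      suc (# remove w (λ v → W v ∧ q a v)) ≤⟨ s≤s (#-mono λ v r → ∧-intro (∧-intro (∧-elimˡ (∧-elimˡ r)) (∧-elimʳ {W v ∧ q a v} r)) (∧-elimʳ {W v} (∧-elimˡ r))) ⟩
      suc (# (λ v → remove w W v ∧ q a v)) ∎)
    big′ : s' * # (remove w W) ^ k < # Aʷ w * M ^ k
    big′ = begin-strict
      s' * # (remove w W) ^ k ≤⟨ *-monoʳ-≤ s' (^-monoˡ-≤ k (#-remove≤ W w)) ⟩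
      s' * # W ^ k ≡⟨ +-identityʳ _ ⟨
      s' * # W ^ k + 0 <⟨ h ⟩
      (# Aʷ w + 0) * M ^ k ≡⟨ cong (_* M ^ k) (+-identityʳ (# Aʷ w)) ⟩
      # Aʷ w * M ^ k ∎
  ... | v , inj , inW , B , big″ , sub , adjv =
    w ∷ v , ∷-injective inj (λ i → ==-≢ (not-true (∧-elimʳ {W (v i)} (inW i)))) , (λ { zero → Ww ; (suc i) → ∧-elimˡ (inW i) }) , B , big″ ,
    (λ a h′ → ∧-elimˡ (sub a h′)) , λ { a zero h′ → ∧-elimʳ {A a} (sub a h′) ; a (suc i) h′ → adjv a i h′ }

adj-≢ : (G : Graph) → ∀ {i j} → adj G i j ≡ true → i ≢ j
adj-≢ G h refl = true≢false h (irrefl G _)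

-- Otherwise `popular-tuple` gives `k` vertices of `W` with more than `s'` common neighbours in `A`.
-- All of `A` is adjacent to `z`, and `z` is outside `W`, so adding `z` completes a forbidden copy
-- of the complete bipartite graph. Fixing `z` in advance is what lowers the exponent to `k`.
codegree-bound : ∀ (G : Graph) k s' → KFree (suc k) s' G →
  ∀ (q : Fin (n G) → Fin (n G) → Bool) z (A W : Fin (n G) → Bool) M →
  (∀ a w → q a w ≡ true → adj G a w ≡ true) → (∀ a → A a ≡ true → adj G a z ≡ true) → W z ≡ false →
  (∀ a → A a ≡ true → M + k ≤ # (λ w → W w ∧ q a w)) → # A * M ^ k ≤ s' * # W ^ k
codegree-bound G k s' free q z A W M q-adj A-adj z∉W deg with s' * # W ^ k <? # A * M ^ k
... | no ¬lt = ≮⇒≥ ¬lt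
... | yes lt with popular-tuple k q s' M A W deg lt
... | w , inj , inW , B , big , sub , adjw = ⊥-elim (free (emb , emb-inj , emb-adj))
  where
  w⁺ : Fin (suc k) → Fin (n G)
  w⁺ = z ∷ w
  w⁺-inj : Injective _≡_ _≡_ w⁺
  w⁺-inj = ∷-injective inj λ i eq → true≢false (subst (λ v → W v ≡ true) eq (inW i)) z∉W
  a : Fin s' → Fin (n G)
  a j = enum B (inject≤ j (<⇒≤ big))
  a-inj : Injective _≡_ _≡_ a
  a-inj eq = Finₚ.inject≤-injective (<⇒≤ big) (<⇒≤ big) _ _ (enum-injective B eq)
  a-w⁺ : ∀ i j → adj G (w⁺ i) (a j) ≡ true
  a-w⁺ zero j = trans (Graph.sym G _ _) (A-adj (a j) (sub _ (enum-true B _)))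
  a-w⁺ (suc i) j = trans (Graph.sym G _ _) (q-adj _ _ (adjw _ i (enum-true B _)))
  branch : Fin (suc k) ⊎ Fin s' → Fin (n G)
  branch (inj₁ i) = w⁺ i
  branch (inj₂ j) = a j
  branch-inj : Injective _≡_ _≡_ branch
  branch-inj {inj₁ i} {inj₁ j} eq = cong inj₁ (w⁺-inj eq)
  -- The two sides are disjoint because they are completely joined and there are no loops.
  branch-inj {inj₁ i} {inj₂ j} eq = ⊥-elim (adj-≢ G (a-w⁺ i j) eq)
  branch-inj {inj₂ i} {inj₁ j} eq = ⊥-elim (adj-≢ G (a-w⁺ j i) (≡-sym eq))
  branch-inj {inj₂ i} {inj₂ j} eq = cong inj₂ (a-inj eq)
  emb : Fin (suc k + s') → Fin (n G)
  emb i = branch (splitAt (suc k) i)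
  emb-inj : Injective _≡_ _≡_ emb
  emb-inj {i} {j} eq = trans (≡-sym (Finₚ.join-splitAt (suc k) s' i)) (trans (cong (Fin.join (suc k) s') (branch-inj {splitAt (suc k) i} {splitAt (suc k) j} eq)) (Finₚ.join-splitAt (suc k) s' j))
  emb-adj : ∀ (i : Fin (suc k)) (j : Fin s') → adj G (emb (i ↑ˡ s')) (emb (suc k ↑ʳ j)) ≡ true
  emb-adj i j rewrite Finₚ.splitAt-↑ˡ (suc k) i s' | Finₚ.splitAt-↑ʳ (suc k) s' j = a-w⁺ i j

-- A bipartite subgraph of large minimum degree

sum-sum-suc : ∀ {n} (f : Fin (suc n) → Fin (suc n) → ℕ) →
  sum (λ i → sum (f i)) ≡ f zero zero + (sum (λ j → f zero (suc j) + f (suc j) zero) + sum (λ i → sum (λ j → f (suc i) (suc j))))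
sum-sum-suc f = begin
  sum (λ i → sum (f i)) ≡⟨ sum-suc _ ⟩
  sum (f zero) + sum (λ i → sum (f (suc i))) ≡⟨ cong₂ _+_ (sum-suc _) (trans (sum-cong λ i → sum-suc _) (sum-+ _ _)) ⟩
  f zero zero + sum (λ j → f zero (suc j)) + (sum (λ i → f (suc i) zero) + rest) ≡⟨ perm (f zero zero) _ _ _ ⟩
  f zero zero + (sum (λ j → f zero (suc j)) + sum (λ i → f (suc i) zero) + rest) ≡⟨ cong (λ v → f zero zero + (v + rest)) (sum-+ _ _) ⟨
  f zero zero + (sum (λ j → f zero (suc j) + f (suc j) zero) + rest) ∎
  where
  open ≡-Reasoning
  rest = sum (λ i → sum (λ j → f (suc i) (suc j)))
  perm : ∀ a b c d → a + b + (c + d) ≡ a + (b + c + d)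
  perm = solve-∀

-- Once the other vertices are split, vertex `zero` joins the side that cuts at least half of its
-- weight to them; the two possible gains add up to that weight.
max-cut : ∀ {n} (f : Fin n → Fin n → ℕ) → (∀ i → f i i ≡ 0) →
  ∃ λ (p : Fin n → Bool) → sum (λ i → sum (f i)) ≤ 2 * sum (λ i → sum (λ j → [ p i xor p j ] * f i j))
max-cut {zero} f diag = (λ ()) , ≤-trans (≤-reflexive (sum-zero λ ())) z≤n
max-cut {suc n} f diag with max-cut (λ i j → f (suc i) (suc j)) (λ i → diag (suc i))
... | p , le = choose
  where
  open ≤-Reasoning
  v : Fin n → ℕ
  v j = f zero (suc j) + f (suc j) zero
  gain : Bool → ℕ
  gain b = sum (λ j → [ b xor p j ] * v j)
  rest = sum (λ i → sum (λ j → f (suc i) (suc j)))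
  cut = sum (λ i → sum (λ j → [ p i xor p j ] * f (suc i) (suc j)))
  gains : gain true + gain false ≡ sum v
  gains = trans (≡-sym (sum-+ _ _)) (sum-cong λ j → pointwise (p j) (v j))
    where
    pointwise : ∀ b x → [ true xor b ] * x + [ false xor b ] * x ≡ x
    pointwise true x = +-identityʳ x
    pointwise false x = trans (+-identityʳ _) (+-identityʳ x)
  cut-∷ : ∀ b → sum (λ i → sum (λ j → [ (b ∷ p) i xor (b ∷ p) j ] * f i j)) ≡ gain b + cut
  cut-∷ b = trans (sum-sum-suc _) (cong₂ _+_ (trans (cong ([ b xor b ] *_) (diag zero)) (*-zeroʳ [ b xor b ]))
    (cong (_+ cut) (sum-cong λ j → trans (cong (λ c → [ b xor p j ] * f zero (suc j) + [ c ] * f (suc j) zero) (xor-comm (p j) b)) (≡-sym (*-distribˡ-+ [ b xor p j ] _ _)))))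
  result : ∀ b → sum v ≤ 2 * gain b → sum (λ i → sum (f i)) ≤ 2 * sum (λ i → sum (λ j → [ (b ∷ p) i xor (b ∷ p) j ] * f i j))
  result b h = begin
    sum (λ i → sum (f i)) ≡⟨ sum-sum-suc f ⟩
    f zero zero + (sum v + rest) ≡⟨ cong (_+ (sum v + rest)) (diag zero) ⟩
    sum v + rest ≤⟨ +-mono-≤ h le ⟩
    2 * gain b + 2 * cut ≡⟨ *-distribˡ-+ 2 (gain b) cut ⟨
    2 * (gain b + cut) ≡⟨ cong (2 *_) (cut-∷ b) ⟨
    2 * sum (λ i → sum (λ j → [ (b ∷ p) i xor (b ∷ p) j ] * f i j)) ∎
  double : ∀ x → x + x ≡ 2 * x
  double = solve-∀
  choose : ∃ λ (p : Fin (suc n) → Bool) → sum (λ i → sum (f i)) ≤ 2 * sum (λ i → sum (λ j → [ p i xor p j ] * f i j))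
  choose with ≤-total (gain true) (gain false)
  ... | inj₁ h = false ∷ p , result false (≤-trans (≤-reflexive (≡-sym gains)) (≤-trans (+-monoˡ-≤ (gain false) h) (≤-reflexive (double (gain false)))))
  ... | inj₂ h = true ∷ p , result true (≤-trans (≤-reflexive (≡-sym gains)) (≤-trans (+-monoʳ-≤ (gain true) h) (≤-reflexive (double (gain true)))))

#-remove : ∀ {n} (p : Fin n → Bool) j → p j ≡ true → # p ≡ suc (# remove j p)
#-remove p j pj = trans (sum-cong λ i → cong [_] (pointwise i)) (#-insert (remove j p) j absent)
  where
  absent : remove j p j ≡ false
  absent = trans (cong (λ b → p j ∧ not b) (==-refl j)) (∧-zeroʳ (p j))
  pointwise : ∀ i → p i ≡ insert j (remove j p) i
  pointwise i with i Fin.≟ j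
  ... | yes refl = pj
  ... | no _ = ≡-sym (∧-identityʳ (p i))

-- Vertices of degree below `d` are deleted one at a time. Each deletion lowers `total`, which
-- counts ordered pairs, by less than `2 * d`, so `Dense` survives; being strict, it also keeps the
-- final set nonempty.
min-degree-subset : ∀ {n} (q : Fin n → Fin n → Bool) → (∀ i j → q i j ≡ q j i) → ∀ d →
  2 * (d * n) < sum (λ u → # q u) →
  ∃ λ (W : Fin n → Bool) → (∃ λ v → W v ≡ true) × (∀ v → W v ≡ true → d ≤ # (λ w → W w ∧ q v w))
min-degree-subset {n} q q-sym d big = descent {S = Σ (Fin n → Bool) Dense} (λ S → # proj₁ S) next ((λ _ → true) , initial)
  where
  open ≤-Reasoning
  total : (Fin n → Bool) → ℕ
  total W = sum (λ u → # (λ w → W u ∧ (W w ∧ q u w)))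
  Dense : (Fin n → Bool) → Set
  Dense W = 2 * (d * # W) < total W
  initial : Dense (λ _ → true)
  initial = ≤-<-trans (*-monoʳ-≤ 2 (*-monoʳ-≤ d (#≤n {n} (λ _ → true)))) big
  next : ∀ S → _ ⊎ ∃ λ S′ → # proj₁ S′ < # proj₁ S
  next (W , dense) with search (λ v → W v ∧ not (d ≤ᵈ # (λ w → W w ∧ q v w)))
  ... | inj₂ none = inj₁ (W , nonempty , λ v Wv → all v Wv (none v))
    where
    all : ∀ v → W v ≡ true → W v ∧ not (d ≤ᵈ # (λ w → W w ∧ q v w)) ≡ false → d ≤ # (λ w → W w ∧ q v w)
    all v Wv f with bool (d ≤ᵈ # (λ w → W w ∧ q v w))
    ... | inj₁ t = ≤ᵈ-true t
    ... | inj₂ t = true≢false (∧-intro Wv (not-false t)) f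
    nonempty : ∃ λ v → W v ≡ true
    nonempty with search W
    ... | inj₁ x = x
    ... | inj₂ empty = ⊥-elim (<⇒≱ dense (≤-trans (≤-reflexive (sum-zero λ u → sum-zero λ w → cong (λ b → [ b ∧ (W w ∧ q u w) ]) (empty u))) z≤n))
  ... | inj₁ (v , h) = inj₂ ((remove v W , dense′) , ≤-reflexive (≡-sym size))
    where
    deg = # (λ w → W w ∧ q v w)
    size : # W ≡ suc (# remove v W)
    size = #-remove W v (∧-elimˡ h)
    deg<d : deg < d
    deg<d = ≤ᵈ-false (not-true (∧-elimʳ {W v} h))
    pointwise : ∀ u w → [ W u ∧ (W w ∧ q u w) ] ≤
      [ remove v W u ∧ (remove v W w ∧ q u w) ] + ([ u == v ] * [ W w ∧ q u w ] + [ w == v ] * [ W u ∧ q u w ])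
    pointwise u w with W u | W w | q u w | u == v | w == v
    ... | false | _ | _ | _ | _ = z≤n
    ... | true | false | _ | _ | _ = z≤n
    ... | true | true | false | _ | _ = z≤n
    ... | true | true | true | true | _ = m≤m+n 1 _
    ... | true | true | true | false | true = ≤-refl
    ... | true | true | true | false | false = ≤-refl
    bound : total W ≤ total (remove v W) + (deg + deg)
    bound = begin
      total W ≤⟨ sum-mono (λ u → sum-mono (pointwise u)) ⟩
      sum (λ u → sum (λ w → [ remove v W u ∧ (remove v W w ∧ q u w) ] + ([ u == v ] * [ W w ∧ q u w ] + [ w == v ] * [ W u ∧ q u w ])))
        ≡⟨ trans (sum-cong λ u → sum-+₃ _ _ _) (sum-+₃ _ _ _) ⟩
      total (remove v W) + (sum (λ u → sum (λ w → [ u == v ] * [ W w ∧ q u w ])) + sum (λ u → sum (λ w → [ w == v ] * [ W u ∧ q u w ])))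
        ≡⟨ cong (total (remove v W) +_) (cong₂ _+_
             (trans (sum-cong λ u → ≡-sym (*-distribˡ-sum [ u == v ] _)) (sum-singleton v (λ u → # (λ w → W w ∧ q u w))))
             (sum-cong λ u → trans (sum-singleton v (λ w → [ W u ∧ q u w ])) (cong (λ b → [ W u ∧ b ]) (q-sym u v)))) ⟩
      total (remove v W) + (deg + deg) ∎
    dense′ : Dense (remove v W)
    dense′ = linarith 2 (+-mono-≤ (≤-trans dense bound) (+-mono-≤ deg<d deg<d))
      (trans (identity d (# remove v W) (total (remove v W)) deg) (cong (λ a → total (remove v W) + (suc (2 * (d * a)) + (suc deg + suc deg))) (≡-sym size)))
      where
      identity : ∀ d r t g → suc (2 * (d * r)) + (t + (g + g) + (d + d)) + 2 ≡ t + (suc (2 * (d * suc r)) + (suc g + suc g))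
      identity = solve-∀

-- A bipartite subgraph whose edges are oriented from `Y` to `X`. Rows are trimmed to exactly `d`,
-- so edge totals are exact on the `Y` side, while degrees in `X` vary.
record Host (G : Graph) (d : ℕ) : Set where
  field
    X Y : Fin (n G) → Bool
    e : Fin (n G) → Fin (n G) → Bool
    disjoint : ∀ v → X v ≡ true → Y v ≡ false
    e-adj : ∀ y x → e y x ≡ true → adj G y x ≡ true
    e-X : ∀ y x → e y x ≡ true → X x ≡ true
    e-Y : ∀ y x → e y x ≡ true → Y y ≡ true
    row : ∀ y → Y y ≡ true → # e y ≡ d
    #X≤#Y : # X ≤ # Y
    Y-nonempty : 0 < # Y

trimmed-host : ∀ G d (X Y : Fin (n G) → Bool) → (∀ v → X v ≡ true → Y v ≡ false) →
  (∀ y → Y y ≡ true → d ≤ # (λ x → X x ∧ adj G y x)) → # X ≤ # Y → 0 < # Y → Host G d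
trimmed-host G d X Y disj deg le nonempty = record
  { X = X ; Y = Y ; e = λ y → proj₁ (rows y) ; disjoint = disj
  ; e-adj = λ y x h → ∧-elimʳ {X x} (proj₁ (proj₁ (proj₂ (rows y)) x h))
  ; e-X = λ y x h → ∧-elimˡ (proj₁ (proj₁ (proj₂ (rows y)) x h))
  ; e-Y = λ y x h → proj₂ (proj₁ (proj₂ (rows y)) x h)
  ; row = λ y → proj₂ (proj₂ (rows y)) ; #X≤#Y = le ; Y-nonempty = nonempty }
  where
  rows : ∀ y → Σ (Fin (n G) → Bool) λ r → (∀ x → r x ≡ true → (X x ∧ adj G y x ≡ true) × Y y ≡ true) × (Y y ≡ true → # r ≡ d)
  rows y with bool (Y y)
  ... | inj₂ ∉Y = (λ _ → false) , (λ _ ()) , λ ∈Y → true≢false ∈Y ∉Y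
  ... | inj₁ ∈Y with trim (λ x → X x ∧ adj G y x) d (deg y ∈Y)
  ... | r , sub , size = r , (λ x h → sub x h , ∈Y) , λ _ → size

-- The cut costs a factor two, and what is left is the density that `min-degree-subset` asks for.
-- The larger side of the surviving graph becomes `Y`.
host : ∀ G d → 4 * (d * n G) < sum (λ i → # adj G i) → Host G d
host G d big with max-cut (λ i j → [ adj G i j ]) (λ i → cong [_] (irrefl G i))
... | p , cut with min-degree-subset (λ i j → (p i xor p j) ∧ adj G i j) (λ i j → cong₂ _∧_ (xor-comm (p i) (p j)) (Graph.sym G i j)) d dense
  where
  open ≤-Reasoning
  dense : 2 * (d * n G) < sum (λ i → # (λ j → (p i xor p j) ∧ adj G i j))
  dense = *-cancelˡ-< 2 _ _ (begin-strict
    2 * (2 * (d * n G)) ≡⟨ *-assoc 2 2 (d * n G) ⟨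
    4 * (d * n G) <⟨ big ⟩
    sum (λ i → # adj G i) ≤⟨ cut ⟩
    2 * sum (λ i → sum (λ j → [ p i xor p j ] * [ adj G i j ])) ≡⟨ cong (2 *_) (sum-cong λ i → sum-cong λ j → [∧] (p i xor p j) (adj G i j)) ⟨
    2 * sum (λ i → # (λ j → (p i xor p j) ∧ adj G i j)) ∎)
... | W , (v , Wv) , deg = sides (≤-total (# side true) (# side false))
  where
  side : Bool → Fin (n G) → Bool
  -- `not (p w xor b)` is the equality of `p w` and `b`.
  side b w = W w ∧ not (p w xor b)
  opposite : ∀ b w → side b w ≡ true → side (not b) w ≡ false
  opposite b w h with W w | p w | b
  ... | true | true | true = refl
  ... | true | false | false = refl
  degree-across : ∀ b y → side b y ≡ true → d ≤ # (λ x → side (not b) x ∧ adj G y x)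
  degree-across b y h = ≤-trans (deg y (∧-elimˡ h)) (#-mono λ x h′ → ∧-intro (∧-intro (∧-elimˡ h′) (across (p y) (p x) b (∧-elimʳ {W y} h) (∧-elimˡ (∧-elimʳ {W x} h′)))) (∧-elimʳ {p y xor p x} (∧-elimʳ {W x} h′)))
    where
    across : ∀ py px b → not (py xor b) ≡ true → py xor px ≡ true → not (px xor not b) ≡ true
    across true false true _ _ = refl
    across false true false _ _ = refl
  positive : ∀ b → # side (not b) ≤ # side b → 0 < # side b
  positive b le with bool (side b v)
  ... | inj₁ t = ≤-trans ([]-intro t) (term≤sum (λ i → [ side b i ]) v)
  -- Here `v` lies on the opposite side, which is therefore nonempty and no larger than this one.
  ... | inj₂ f = ≤-trans ([]-intro (other (W v) (p v) b Wv f)) (≤-trans (term≤sum (λ i → [ side (not b) i ]) v) le)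
    where
    other : ∀ w p b → w ≡ true → w ∧ not (p xor b) ≡ false → w ∧ not (p xor not b) ≡ true
    other true true false _ _ = refl
    other true false true _ _ = refl
  build : ∀ b → # side (not b) ≤ # side b → Host G d
  build b le = trimmed-host G d (side (not b)) (side b) (λ w h → subst (λ c → side c w ≡ false) (not-involutive b) (opposite (not b) w h)) (degree-across b) le (positive b le)
  sides : # side true ≤ # side false ⊎ # side false ≤ # side true → Host G d
  sides (inj₁ le) = build false le
  sides (inj₂ le) = build true le

-- Contracting branch sets

length-filter-tabulate : ∀ {n m} (p : Fin m → Bool) (f : Fin n → Fin m) →
  List.length (List.filter (λ j → p j Bool.≟ true) (List.tabulate f)) ≡ # (p ∘ f)
length-filter-tabulate {zero} p f = ≡-sym (sum-zero λ ())
length-filter-tabulate {suc n} p f with p (f zero) in eq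
... | true = trans (cong suc (length-filter-tabulate p (f ∘ suc))) (≡-sym (trans (sum-suc _) (cong (λ c → [ c ] + # (p ∘ f ∘ suc)) eq)))
... | false = trans (length-filter-tabulate p (f ∘ suc)) (≡-sym (trans (sum-suc _) (cong (λ c → [ c ] + # (p ∘ f ∘ suc)) eq)))

sum-map-tabulate : ∀ {n m} (g : Fin m → ℕ) (f : Fin n → Fin m) → List.sum (List.map g (List.tabulate f)) ≡ sum (g ∘ f)
sum-map-tabulate {zero} g f = ≡-sym (sum-zero λ ())
sum-map-tabulate {suc n} g f = trans (cong (g (f zero) +_) (sum-map-tabulate g (f ∘ suc))) (≡-sym (sum-suc _))

degSum-# : ∀ G → degSum G ≡ sum (λ i → # adj G i)
degSum-# G = trans (sum-map-tabulate (degree G) (λ i → i)) (sum-cong λ i → length-filter-tabulate (adj G i) (λ j → j))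

-- Walks inside a vertex set

module _ {G : Graph} where

  walk-map : ∀ {P Q : Fin (n G) → Set} {x y} → (∀ {z} → P z → Q z) → WalkIn G P x y → WalkIn G Q x y
  walk-map h (here p) = here (h p)
  walk-map h (step p a w) = step (h p) a (walk-map h w)

  module _ {P : Fin (n G) → Set} where

    walk-source : ∀ {x y} → WalkIn G P x y → P x
    walk-source (here p) = p
    walk-source (step p _ _) = p

    walk-trans : ∀ {x y z} → WalkIn G P x y → WalkIn G P y z → WalkIn G P x z
    walk-trans (here _) w = w
    walk-trans (step p a v) w = step p a (walk-trans v w)

    walk-sym : ∀ {x y} → WalkIn G P x y → WalkIn G P y x
    walk-sym (here p) = here p
    walk-sym (step p a w) = walk-trans (walk-sym w) (step (walk-source w) (trans (Graph.sym G _ _) a) (here p))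

find : ∀ {n} → (Fin n → Bool) → Maybe (Fin n)
find p with search p
... | inj₁ (i , _) = just i
... | inj₂ _ = nothing

find-just : ∀ {n} (p : Fin n → Bool) {i} → find p ≡ just i → p i ≡ true
find-just p eq with search p
find-just p refl | inj₁ (i , t) = t

find-unique : ∀ {n} (p : Fin n → Bool) {i} → (∀ j → p j ≡ true → j ≡ i) → p i ≡ true → find p ≡ just i
find-unique p {i} uniq t with search p
... | inj₁ (j , t′) = cong just (uniq j t′)
... | inj₂ none = true≢false t (none i)

-- Branch sets are indexed by representatives: member L v says that v lies in the branch set of L.
contract : ∀ (G : Graph) (𝓛 : Fin (n G) → Bool) (member arc : Fin (n G) → Fin (n G) → Bool) →
  (∀ L → 𝓛 L ≡ true → member L L ≡ true) →
  (∀ L L′ v → 𝓛 L ≡ true → 𝓛 L′ ≡ true → member L v ≡ true → member L′ v ≡ true → L ≡ L′) →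
  (∀ L v → 𝓛 L ≡ true → member L v ≡ true → WalkIn G (λ z → member L z ≡ true) v L) →
  (∀ L → arc L L ≡ false) →
  (∀ L L′ → arc L L′ ≡ true → ∃ λ x → ∃ λ y → member L x ≡ true × member L′ y ≡ true × adj G x y ≡ true) →
  Σ Graph λ Γ → n Γ ≡ # 𝓛 × IsMinor Γ G × sum (λ L → [ 𝓛 L ] * # (λ L′ → 𝓛 L′ ∧ arc L L′)) ≤ degSum Γ
contract G 𝓛 member arc root unique path arc-irrefl realise = Γ , refl , (β , inhabited , connected , edges) , arcs≤
  where
  ι : Fin (# 𝓛) → Fin (n G)
  ι = enum 𝓛
  Γ : Graph
  Γ = record
    -- Arcs are symmetrised. The degree sum counts ordered pairs, so each arc between
    -- representatives still contributes one.
    { n = # 𝓛 ; adj = λ u w → arc (ι u) (ι w) ∨ arc (ι w) (ι u) ; sym = λ u w → ∨-comm (arc (ι u) (ι w)) _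
    ; irrefl = λ u → cong₂ _∨_ (arc-irrefl (ι u)) (arc-irrefl (ι u)) }
  β : Fin (n G) → Maybe (Fin (# 𝓛))
  β v = find (λ u → member (ι u) v)
  β-intro : ∀ {u v} → member (ι u) v ≡ true → β v ≡ just u
  β-intro {u} {v} t = find-unique _ (λ w t′ → enum-injective 𝓛 (unique (ι w) (ι u) v (enum-true 𝓛 w) (enum-true 𝓛 u) t′ t)) t
  β-elim : ∀ {u v} → β v ≡ just u → member (ι u) v ≡ true
  β-elim {u} {v} = find-just (λ w → member (ι w) v)
  inhabited : ∀ u → ∃ λ x → β x ≡ just u
  inhabited u = ι u , β-intro (root (ι u) (enum-true 𝓛 u))
  to-root : ∀ u x → β x ≡ just u → WalkIn G (λ z → β z ≡ just u) x (ι u)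
  to-root u x eq = walk-map β-intro (path (ι u) x (enum-true 𝓛 u) (β-elim eq))
  connected : ∀ u x y → β x ≡ just u → β y ≡ just u → WalkIn G (λ z → β z ≡ just u) x y
  connected u x y p q = walk-trans (to-root u x p) (walk-sym (to-root u y q))
  edges : ∀ u u′ → adj Γ u u′ ≡ true → ∃ λ x → ∃ λ y → β x ≡ just u × β y ≡ just u′ × adj G x y ≡ true
  edges u u′ t with ∨-elim {arc (ι u) (ι u′)} t
  ... | inj₁ a = let x , y , p , q , r = realise _ _ a in x , y , β-intro p , β-intro q , r
  ... | inj₂ a = let x , y , p , q , r = realise _ _ a in y , x , β-intro q , β-intro p , trans (Graph.sym G y x) r
  open ≤-Reasoning
  arcs≤ : sum (λ L → [ 𝓛 L ] * # (λ L′ → 𝓛 L′ ∧ arc L L′)) ≤ degSum Γ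
  arcs≤ = begin
    sum (λ L → [ 𝓛 L ] * # (λ L′ → 𝓛 L′ ∧ arc L L′)) ≡⟨ sum-enum 𝓛 _ ⟨
    sum (λ u → # (λ L′ → 𝓛 L′ ∧ arc (ι u) L′)) ≡⟨ sum-cong (λ u → trans (sum-cong λ L′ → [∧] (𝓛 L′) _) (≡-sym (sum-enum 𝓛 _))) ⟩
    sum (λ u → # (λ w → arc (ι u) (ι w))) ≤⟨ sum-mono (λ u → #-mono λ w → ∨-introˡ) ⟩
    sum (λ u → # adj Γ u) ≡⟨ degSum-# Γ ⟨
    degSum Γ ∎

-- Bags: stars whose leaves have many distinct neighbours

#-split : ∀ {n} (p q : Fin n → Bool) → # p ≡ # (λ i → p i ∧ q i) + # (λ i → p i ∧ not (q i))
#-split p q = trans (sum-cong λ i → pointwise (p i) (q i)) (sum-+ _ _)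
  where
  pointwise : ∀ a b → [ a ] ≡ [ a ∧ b ] + [ a ∧ not b ]
  pointwise true true = refl
  pointwise true false = refl
  pointwise false b = refl

^-distribʳ-* : ∀ k a b → (a * b) ^ k ≡ a ^ k * b ^ k
^-distribʳ-* zero a b = refl
^-distribʳ-* (suc k) a b = trans (cong (a * b *_) (^-distribʳ-* k a b)) (interchange a b (a ^ k) (b ^ k))
  where
  interchange : ∀ a b c d → a * b * (c * d) ≡ a * c * (b * d)
  interchange = solve-∀

^-doubles : ∀ b k → 1 ≤ b → 1 ≤ k → b ≤ b ^ k * b ^ k
^-doubles b (suc k) 1≤b 1≤k = begin
  b ≡⟨ *-identityʳ b ⟨
  b * 1 ≤⟨ *-monoʳ-≤ b (m^n>0′ k) ⟩
  b ^ suc k ≡⟨ *-identityʳ _ ⟨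
  b ^ suc k * 1 ≤⟨ *-monoʳ-≤ (b ^ suc k) (m^n>0′ (suc k)) ⟩
  b ^ suc k * b ^ suc k ∎
  where
  open ≤-Reasoning
  m^n>0′ : ∀ k → 1 ≤ b ^ k
  m^n>0′ k = ≤-trans (≤-reflexive (≡-sym (^-zeroˡ k))) (^-monoˡ-≤ k 1≤b)

-- Degree thresholds are multiples of g = d / 256, and b * m is the out-degree at which a bag is saturated.
module Bagging (G : Graph) (k s' m b g d : ℕ) (free : KFree (suc k) s' G) (1≤k : 1 ≤ k) (k<s' : k < s')
  (16≤b : 16 ≤ b) (b²ᵏ≤m : b ^ k * b ^ k ≤ m) (g≡ : g ≡ 2 * (s' * m)) (d≡ : d ≡ 256 * g) (H : Host G d) where

  open Host H

  V : Set
  V = Fin (n G)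

  nb : (V → Bool) → V → Bool
  nb L y = anyᵇ (λ x → L x ∧ e y x)

  deg : V → ℕ
  deg x = # (λ y → e y x)

  weight : (V → Bool) → ℕ
  weight L = sum (λ x → [ L x ] * deg x)

  1≤b : 1 ≤ b
  1≤b = ≤-trans (s≤s z≤n) 16≤b

  b≤m : b ≤ m
  b≤m = ≤-trans (^-doubles b k 1≤b 1≤k) b²ᵏ≤m

  1≤m : 1 ≤ m
  1≤m = ≤-trans 1≤b b≤m

  1≤s' : 1 ≤ s'
  1≤s' = ≤-trans (s≤s z≤n) k<s'

  m≤s'm : m ≤ s' * m
  m≤s'm = ≤-trans (≤-reflexive (≡-sym (*-identityˡ m))) (*-monoˡ-≤ m 1≤s')

  k≤s'm : k ≤ s' * m
  k≤s'm = ≤-trans (<⇒≤ k<s') (≤-trans (≤-reflexive (≡-sym (*-identityʳ s'))) (*-monoʳ-≤ s' 1≤m))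

  s'm≤g : s' * m ≤ g
  s'm≤g = ≤-trans (m≤m+n _ _) (≤-reflexive (≡-sym g≡))

  k≤g : k ≤ g
  k≤g = ≤-trans k≤s'm s'm≤g

  -- The invariants of the greedy growth: `fresh` says that, up to a factor two, the edges at the
  -- leaves go to distinct vertices.
  record Bag (R : V → Bool) : Set where
    field
      L : V → Bool
      L⊆R : ∀ x → L x ≡ true → R x ≡ true
      few : # L ≤ 8 * b
      fresh : weight L ≤ 2 * # nb L

  -- Leaves are added while some candidate sends at least half of its edges outside `nb L`. If this
  -- stops early, every remaining candidate sends more than half of its edges into the small set
  -- `nb L`; all of them are adjacent to `y₀`, so `codegree-bound` shows that there are too few of
  -- them.
  grow-bag : ∀ y₀ (R : V → Bool) → (∀ x → R x ≡ true → e y₀ x ≡ true) → (∀ x → R x ≡ true → 64 * g ≤ deg x) →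
    32 * g ≤ # R → Σ (Bag R) λ B → b * d ≤ # nb (Bag.L B)
  grow-bag y₀ R R-e R-deg big = descent (λ B → 8 * b ∸ # Bag.L B) next empty
    where
    open ≤-Reasoning
    empty : Bag R
    empty = record { L = λ _ → false ; L⊆R = λ _ () ; few = ≤-trans (≤-reflexive (sum-zero λ _ → refl)) z≤n
      ; fresh = ≤-trans (≤-reflexive (sum-zero λ _ → refl)) z≤n }
    next : ∀ B → (Σ (Bag R) λ B → b * d ≤ # nb (Bag.L B)) ⊎ ∃ λ B′ → 8 * b ∸ # Bag.L B′ < 8 * b ∸ # Bag.L B
    next B with b * d ≤? # nb (Bag.L B)
    ... | yes wide = inj₁ (B , wide)
    ... | no ¬wide with search (λ x → (R x ∧ not (Bag.L B x)) ∧ (2 * # (λ y → e y x ∧ nb (Bag.L B) y) ≤ᵈ deg x))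
    ... | inj₁ (x , h) = inj₂ (B′ , ∸-monoʳ-< (≤-reflexive (≡-sym size)) few′)
      where
      open Bag B
      x∉L : L x ≡ false
      x∉L = not-true (∧-elimʳ {R x} (∧-elimˡ h))
      size : # insert x L ≡ suc (# L)
      size = #-insert L x x∉L
      narrow : # nb L < b * d
      narrow = ≰⇒> ¬wide
      -- Each leaf has at least `64 * g` edges, while freshness keeps the weight below
      -- `2 * (b * d)`, which is `8 * b` times `64 * g`.
      small : # L < 8 * b
      small = *-cancelʳ-< (64 * g) (# L) (8 * b) (begin-strict
        # L * (64 * g) ≡⟨ sum-[]* L (64 * g) ⟨
        sum (λ x → [ L x ] * (64 * g)) ≤⟨ sum-mono (λ x → []*-monoʳ (L x) λ Lx → R-deg x (L⊆R x Lx)) ⟩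
        weight L ≤⟨ fresh ⟩
        2 * # nb L <⟨ *-monoʳ-< 2 narrow ⟩
        2 * (b * d) ≡⟨ cong (λ d → 2 * (b * d)) d≡ ⟩
        2 * (b * (256 * g)) ≡⟨ identity b g ⟩
        8 * b * (64 * g) ∎)
        where
        identity : ∀ b g → 2 * (b * (256 * g)) ≡ 8 * b * (64 * g)
        identity = solve-∀
      few′ : # insert x L ≤ 8 * b
      few′ = ≤-trans (≤-reflexive size) small
      old new : ℕ
      old = # (λ y → e y x ∧ nb L y)
      new = # (λ y → e y x ∧ not (nb L y))
      gain : # nb L + new ≤ # nb (insert x L)
      gain = ≤-trans (≤-reflexive (≡-sym (sum-+ _ _))) (sum-mono λ y → pointwise y (nb L y) refl)
        where
        pointwise : ∀ y c → nb L y ≡ c → [ c ] + [ e y x ∧ not c ] ≤ [ nb (insert x L) y ]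
        pointwise y true eq with any-elim _ eq
        ... | x′ , h′ = ≤-trans (+-monoʳ-≤ 1 (≤-reflexive (cong [_] (∧-zeroʳ (e y x)))))
          ([]-intro (any-intro _ x′ (∧-intro (∨-introʳ {x′ == x} (∧-elimˡ h′)) (∧-elimʳ {L x′} h′))))
        pointwise y false eq = []-mono λ h′ → any-intro _ x (∧-intro (∨-introˡ (==-refl x)) (∧-elimˡ h′))
      B′ : Bag R
      B′ = record
        { L = insert x L
        ; L⊆R = λ x′ h′ → sub x′ (∨-elim h′)
        ; few = few′
        ; fresh = begin
            weight (insert x L) ≡⟨ sum-insert L x deg x∉L ⟩
            deg x + weight L ≤⟨ +-monoʳ-≤ (deg x) fresh ⟩
            deg x + 2 * # nb L ≤⟨ linarith 0 (+-mono-≤ (≤-reflexive (cong (2 *_) (#-split (λ y → e y x) (nb L)))) (≤ᵈ-true (∧-elimʳ {R x ∧ not (L x)} h))) (identity (deg x) (# nb L) old new) ⟩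
            2 * (# nb L + new) ≤⟨ *-monoʳ-≤ 2 gain ⟩
            2 * # nb (insert x L) ∎ }
        where
        sub : ∀ x′ → (x′ == x) ≡ true ⊎ L x′ ≡ true → R x′ ≡ true
        sub x′ (inj₁ eq) = subst (λ v → R v ≡ true) (≡-sym (==-≡ eq)) (∧-elimˡ (∧-elimˡ h))
        sub x′ (inj₂ Lx) = L⊆R x′ Lx
        identity : ∀ a l o w → a + 2 * l + (2 * (o + w) + a) + 0 ≡ 2 * (l + w) + (2 * a + 2 * o)
        identity = solve-∀
    ... | inj₂ none = ⊥-elim (<⇒≱ 0<s'm contra)
      where
      open Bag B
      A W : V → Bool
      A x = R x ∧ not (L x)
      -- `y₀` takes the role of `z` in `codegree-bound`, so it must not lie in `W`.
      W = remove y₀ (nb L)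
      narrow : # W ≤ b * d
      narrow = ≤-trans (#-remove≤ (nb L) y₀) (<⇒≤ (≰⇒> ¬wide))
      0<s'm : 0 < s' * m
      0<s'm = ≤-trans 1≤m m≤s'm
      y₀∉W : W y₀ ≡ false
      y₀∉W = trans (cong (λ c → nb L y₀ ∧ not c) (==-refl y₀)) (∧-zeroʳ (nb L y₀))
      crowded : ∀ a → A a ≡ true → 16 * g + k ≤ # (λ w → W w ∧ e w a)
      crowded a Aa = begin
        16 * g + k ≤⟨ +-monoʳ-≤ (16 * g) k≤g ⟩
        16 * g + g ≤⟨ m≤m+n _ (15 * g) ⟩
        16 * g + g + 15 * g ≡⟨ identity g ⟩
        -- More than half of `64 * g` edges is strictly more than `32 * g`; the surplus one pays for
        -- the removal of `y₀`.
        32 * g ≤⟨ s≤s⁻¹ (≤-trans (*-cancelˡ-< 2 (32 * g) old half) (≤-trans (#-remove≥ (λ y → e y a ∧ nb L y) y₀) (s≤s (#-mono rearrange)))) ⟩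
        # (λ w → W w ∧ e w a) ∎
        where
        old = # (λ y → e y a ∧ nb L y)
        identity : ∀ g → 16 * g + g + 15 * g ≡ 32 * g
        identity = solve-∀
        identity′ : ∀ g → 2 * (32 * g) ≡ 64 * g
        identity′ = solve-∀
        half : 2 * (32 * g) < 2 * old
        half = ≤-<-trans (≤-trans (≤-reflexive (identity′ g)) (R-deg a (∧-elimˡ Aa))) (≤ᵈ-false (¬true λ t → true≢false (∧-intro Aa t) (none a)))
        rearrange : ∀ y → remove y₀ (λ y → e y a ∧ nb L y) y ≡ true → W y ∧ e y a ≡ true
        rearrange y h = ∧-intro (∧-intro (∧-elimʳ {e y a} (∧-elimˡ h)) (∧-elimʳ {e y a ∧ nb L y} h)) (∧-elimˡ (∧-elimˡ h))
      #A≤ : # A ≤ s' * m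
      #A≤ = *-cancelʳ-≤ (# A) (s' * m) ((16 * g) ^ k) {{m^n≢0 (16 * g) k {{>-nonZero 0<16g}}}} (begin
        # A * (16 * g) ^ k ≤⟨ codegree-bound G k s' free (λ x y → e y x) y₀ A W (16 * g)
             (λ a w h → trans (Graph.sym G a w) (e-adj w a h)) (λ a h → trans (Graph.sym G a y₀) (e-adj y₀ a (R-e a (∧-elimˡ h)))) y₀∉W crowded ⟩
        s' * # W ^ k ≤⟨ *-monoʳ-≤ s' (^-monoˡ-≤ k narrow) ⟩
        s' * (b * d) ^ k ≡⟨ cong (λ d → s' * (b * d) ^ k) d≡ ⟩
        s' * (b * (256 * g)) ^ k ≡⟨ cong (λ x → s' * x ^ k) (identity b g) ⟩
        s' * (16 * b * (16 * g)) ^ k ≡⟨ cong (s' *_) (^-distribʳ-* k (16 * b) (16 * g)) ⟩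
        s' * ((16 * b) ^ k * (16 * g) ^ k) ≡⟨ *-assoc s' _ _ ⟨
        -- The ratio 16 between `d` and the threshold `16 * g` is absorbed by a second factor `b`;
        -- hence the condition on `b` to the power `2 * k`.
        s' * (16 * b) ^ k * (16 * g) ^ k ≤⟨ *-monoˡ-≤ ((16 * g) ^ k) (*-monoʳ-≤ s' (^-monoˡ-≤ k (*-monoˡ-≤ b 16≤b))) ⟩
        s' * (b * b) ^ k * (16 * g) ^ k ≡⟨ cong (λ x → s' * x * (16 * g) ^ k) (^-distribʳ-* k b b) ⟩
        s' * (b ^ k * b ^ k) * (16 * g) ^ k ≤⟨ *-monoˡ-≤ ((16 * g) ^ k) (*-monoʳ-≤ s' b²ᵏ≤m) ⟩
        s' * m * (16 * g) ^ k ∎)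
        where
        0<16g : 0 < 16 * g
        0<16g = ≤-trans 0<s'm (≤-trans s'm≤g (m≤m+n g _))
        identity : ∀ b g → b * (256 * g) ≡ 16 * b * (16 * g)
        identity = solve-∀
      -- There are at least `32 * g`, that is `64 * (s' * m)`, candidates, but leaves and blocked
      -- candidates together number at most `9 * (s' * m)`.
      contra : s' * m ≤ 0
      contra = linarith (54 * (s' * m)) (begin
        32 * g ≤⟨ big ⟩
        # R ≡⟨ #-split R L ⟩
        # (λ x → R x ∧ L x) + # A ≤⟨ +-mono-≤ (≤-trans (#-mono λ x → ∧-elimʳ {R x}) few) #A≤ ⟩
        8 * b + s' * m ≤⟨ +-monoˡ-≤ (s' * m) (*-monoʳ-≤ 8 (≤-trans b≤m m≤s'm)) ⟩
        8 * (s' * m) + s' * m ∎) (trans (identity (s' * m)) (cong (32 *_) (≡-sym g≡)))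
        where
        identity : ∀ t → t + (8 * t + t) + 54 * t ≡ 32 * (2 * t)
        identity = solve-∀

  -- Maximal families of disjoint bags

  record Bags : Set where
    field
      C : V → Bool
      leaf : V → V → Bool
      C-Y : ∀ c → C c ≡ true → Y c ≡ true
      leaf-C : ∀ c x → leaf c x ≡ true → C c ≡ true
      leaf-e : ∀ c x → leaf c x ≡ true → e c x ≡ true
      leaf-unique : ∀ c c′ x → leaf c x ≡ true → leaf c′ x ≡ true → c ≡ c′
      few : ∀ c → C c ≡ true → # leaf c ≤ 8 * b
      wide : ∀ c → C c ≡ true → b * d ≤ # nb (leaf c)
      fresh : ∀ c → C c ≡ true → weight (leaf c) ≤ 2 * # nb (leaf c)

    used : V → Bool
    used x = anyᵇ (λ c → leaf c x)

    spare : V → Bool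
    spare x = (64 * g ≤ᵈ deg x) ∧ not (used x)

  -- Growing inside the spare neighbours of `y₀` keeps the new leaves off all earlier bags.
  add-bag : (B : Bags) → let open Bags B in ∀ y₀ → Y y₀ ≡ true → C y₀ ≡ false →
    32 * g ≤ # (λ x → e y₀ x ∧ spare x) → Σ Bags λ B′ → # Bags.C B′ ≡ suc (# C)
  add-bag B y₀ ∈Y ∉C big with grow-bag y₀ (λ x → e y₀ x ∧ Bags.spare B x) (λ x → ∧-elimˡ) (λ x h → ≤ᵈ-true (∧-elimˡ (∧-elimʳ {e y₀ x} h))) big
  ... | bag , wide₀ = B′ , #-insert C y₀ ∉C
    where
    open Bags B
    open Bag bag using (L; L⊆R) renaming (few to few₀; fresh to fresh₀)
    C′ : V → Bool
    C′ = insert y₀ C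
    leaf′ : V → V → Bool
    leaf′ c = if c == y₀ then L else leaf c
    cases : ∀ c → (c ≡ y₀ × leaf′ c ≡ L) ⊎ (c ≢ y₀ × leaf′ c ≡ leaf c × C′ c ≡ C c)
    cases c with c Fin.≟ y₀
    ... | yes eq = inj₁ (eq , refl)
    ... | no ≢ = inj₂ (≢ , refl , refl)
    C′-y₀ : ∀ {c} → c ≡ y₀ → C′ c ≡ true
    C′-y₀ refl = ∨-introˡ (==-refl y₀)
    lift : (P : V → (V → Bool) → Set) → P y₀ L → (∀ c → C c ≡ true → P c (leaf c)) → ∀ c → C′ c ≡ true → P c (leaf′ c)
    lift P new old c h with cases c
    ... | inj₁ (refl , eq) = subst (P c) (≡-sym eq) new
    ... | inj₂ (_ , eq , eq′) = subst (P c) (≡-sym eq) (old c (trans (≡-sym eq′) h))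
    owner : ∀ c x → leaf′ c x ≡ true → (c ≡ y₀ × L x ≡ true) ⊎ leaf c x ≡ true
    owner c x h with cases c
    ... | inj₁ (eq , eq′) = inj₁ (eq , trans (cong (λ f → f x) (≡-sym eq′)) h)
    ... | inj₂ (_ , eq , _) = inj₂ (trans (cong (λ f → f x) (≡-sym eq)) h)
    clash : ∀ c x → L x ≡ true → leaf c x ≡ true → {A : Set} → A
    clash c x Lx lf = true≢false (any-intro _ c lf) (not-true (∧-elimʳ {64 * g ≤ᵈ deg x} (∧-elimʳ {e y₀ x} (L⊆R x Lx))))
    B′ : Bags
    B′ = record
      { C = C′ ; leaf = leaf′
      ; C-Y = lift (λ c _ → Y c ≡ true) ∈Y C-Y
      ; leaf-C = λ c x h → centre c x (owner c x h)
      ; leaf-e = λ c x h → edge c x (owner c x h)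
      ; leaf-unique = λ c c′ x h h′ → unique c c′ x (owner c x h) (owner c′ x h′)
      ; few = lift (λ _ L → # L ≤ 8 * b) few₀ few
      ; wide = lift (λ _ L → b * d ≤ # nb L) wide₀ wide
      ; fresh = lift (λ _ L → weight L ≤ 2 * # nb L) fresh₀ fresh }
      where
      Owner : V → V → Set
      Owner c x = (c ≡ y₀ × L x ≡ true) ⊎ leaf c x ≡ true
      centre : ∀ c x → Owner c x → C′ c ≡ true
      centre c x (inj₁ (eq , _)) = C′-y₀ eq
      centre c x (inj₂ lf) = ∨-introʳ {c == y₀} (leaf-C c x lf)
      edge : ∀ c x → Owner c x → e c x ≡ true
      edge c x (inj₁ (refl , Lx)) = ∧-elimˡ (L⊆R x Lx)
      edge c x (inj₂ lf) = leaf-e c x lf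
      unique : ∀ c c′ x → Owner c x → Owner c′ x → c ≡ c′
      unique c c′ x (inj₁ (eq , _)) (inj₁ (eq′ , _)) = trans eq (≡-sym eq′)
      unique c c′ x (inj₁ (_ , Lx)) (inj₂ lf) = clash c′ x Lx lf
      unique c c′ x (inj₂ lf) (inj₁ (_ , Lx)) = clash c x Lx lf
      unique c c′ x (inj₂ lf) (inj₂ lf′) = leaf-unique c c′ x lf lf′

  Maximal : Bags → Set
  Maximal B = let open Bags B in ∀ y → Y y ≡ true → C y ≡ false → # (λ x → e y x ∧ spare x) < 32 * g

  maximal-bags : Σ Bags Maximal
  maximal-bags = descent (λ B → n G ∸ # Bags.C B) next none
    where
    none : Bags
    none = record { C = λ _ → false ; leaf = λ _ _ → false ; C-Y = λ _ () ; leaf-C = λ _ _ () ; leaf-e = λ _ _ ()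
      ; leaf-unique = λ _ _ _ () ; few = λ _ () ; wide = λ _ () ; fresh = λ _ () }
    next : ∀ B → Σ Bags Maximal ⊎ ∃ λ B′ → n G ∸ # Bags.C B′ < n G ∸ # Bags.C B
    next B with search (λ y → (Y y ∧ not (Bags.C B y)) ∧ (32 * g ≤ᵈ # (λ x → e y x ∧ Bags.spare B x)))
    ... | inj₂ stop = inj₁ (B , λ y ∈Y ∉C → ≤ᵈ-false (¬true λ t → true≢false (∧-intro (∧-intro ∈Y (not-false ∉C)) t) (stop y)))
    ... | inj₁ (y , h) with add-bag B y (∧-elimˡ (∧-elimˡ h)) (not-true (∧-elimʳ {Y y} (∧-elimˡ h))) (≤ᵈ-true (∧-elimʳ {Y y ∧ not (Bags.C B y)} h))
    ... | B′ , size = inj₂ (B′ , ∸-monoʳ-< (≤-reflexive (≡-sym size)) (#≤n (Bags.C B′)))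

  sum-deg : sum deg ≡ # Y * d
  sum-deg = trans (sum-comm (λ x y → [ e y x ])) (trans (sum-cong row-size) (sum-[]* Y d))
    where
    row-size : ∀ y → # e y ≡ [ Y y ] * d
    row-size y with bool (Y y)
    ... | inj₁ t = trans (row y t) (trans (≡-sym (+-identityʳ d)) (cong (λ c → [ c ] * d) (≡-sym t)))
    ... | inj₂ f = trans (sum-zero λ x → cong [_] (¬true λ h → true≢false (e-Y y x h) f)) (cong (λ c → [ c ] * d) (≡-sym f))

  sum-weight : ∀ L → sum (λ y → # (λ x → L x ∧ e y x)) ≡ weight L
  sum-weight L = ≡-sym (double-count L (λ x y → e y x))

  nb≤weight : ∀ L → # nb L ≤ weight L
  nb≤weight L = ≤-trans (sum-mono λ y → any≤# (λ x → L x ∧ e y x)) (≤-reflexive (sum-weight L))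

  -- Counting the edges absorbed by the bags

  module Accounting (B : Bags) where
    open Bags B

    T : (V → Bool) → V → ℕ
    T 𝓛 y = # (λ c → 𝓛 c ∧ nb (leaf c) y)

    -- The potential of a family. Only bags seen beyond the first `16 * g` count, since a vertex
    -- becomes a candidate for attachment only at that threshold.
    h : (V → Bool) → ℕ
    h 𝓛 = sum (λ y → [ not (C y) ] * (T 𝓛 y ∸ 16 * g))

    leaves-weight : sum (λ c → weight (leaf c)) ≡ sum (λ x → # (λ c → leaf c x) * deg x)
    leaves-weight = trans (sum-comm (λ c x → [ leaf c x ] * deg x)) (sum-cong λ x → ≡-sym (*-distribʳ-sum (deg x) (λ c → [ leaf c x ])))

    P : ℕ
    P = sum (λ c → [ C c ] * # nb (leaf c))

    -- Leaves of different bags are disjoint, so no edge of the host is counted twice.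
    P≤ : P ≤ # Y * d
    P≤ = begin
      P ≤⟨ sum-mono (λ c → []*≤ (C c) λ _ → nb≤weight (leaf c)) ⟩
      sum (λ c → weight (leaf c)) ≡⟨ leaves-weight ⟩
      sum (λ x → # (λ c → leaf c x) * deg x) ≤⟨ sum-mono (λ x → ≤-trans (*-monoˡ-≤ (deg x) (unique⇒#≤ (λ c → leaf c x) {true} (λ _ _ → refl) (λ c c′ → leaf-unique c c′ x))) (≤-reflexive (*-identityˡ (deg x)))) ⟩
      sum deg ≡⟨ sum-deg ⟩
      # Y * d ∎
      where open ≤-Reasoning

    0<d : 0 < d
    0<d = subst (0 <_) (≡-sym d≡) (≤-trans 1≤m (≤-trans m≤s'm (≤-trans s'm≤g (m≤m+n g _))))

    -- Each bag is seen by at least `b * d` vertices, and `P≤` bounds the total.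
    #C*b≤#Y : # C * b ≤ # Y
    #C*b≤#Y = *-cancelʳ-≤ (# C * b) (# Y) d {{>-nonZero 0<d}} (begin
      # C * b * d ≡⟨ *-assoc (# C) b d ⟩
      # C * (b * d) ≡⟨ sum-[]* C (b * d) ⟨
      sum (λ c → [ C c ] * (b * d)) ≤⟨ sum-mono (λ c → []*-monoʳ (C c) (wide c)) ⟩
      P ≤⟨ P≤ ⟩
      # Y * d ∎)
      where open ≤-Reasoning

    T≤row : ∀ 𝓛 y → T 𝓛 y ≤ # e y
    T≤row 𝓛 y = begin
      T 𝓛 y ≤⟨ sum-mono (λ c → ≤-trans ([]-mono (∧-elimʳ {𝓛 c})) (any≤# (λ x → leaf c x ∧ e y x))) ⟩
      sum (λ c → # (λ x → leaf c x ∧ e y x)) ≡⟨ sum-comm (λ c x → [ leaf c x ∧ e y x ]) ⟩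
      sum (λ x → # (λ c → leaf c x ∧ e y x)) ≤⟨ sum-mono (λ x → unique⇒#≤ (λ c → leaf c x ∧ e y x) (λ c → ∧-elimʳ {leaf c x}) λ c c′ p q → leaf-unique c c′ x (∧-elimˡ p) (∧-elimˡ q)) ⟩
      # e y ∎
      where open ≤-Reasoning

    T≤d : ∀ 𝓛 y → T 𝓛 y ≤ [ Y y ] * d
    T≤d 𝓛 y with bool (Y y)
    ... | inj₁ t = ≤-trans (T≤row 𝓛 y) (≤-trans (≤-reflexive (row y t)) (≤[]* t))
    ... | inj₂ f = ≤-trans (T≤row 𝓛 y) (≤-trans (≤-reflexive (sum-zero λ x → cong [_] (¬true λ p → true≢false (e-Y y x p) f))) z≤n)

    module _ (maximal : Maximal B) where

      -- Each edge is charged to its end in `X`, which has low degree, is spare, or is a leaf.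
      -- Maximality bounds the spare edges at every non-centre, a centre is charged its whole row,
      -- and freshness compares the edges at leaves with `P`.
      edges : # Y * d ≤ # X * (64 * g) + (# Y * (32 * g) + # C * d + 2 * P)
      edges = begin
        # Y * d ≡⟨ sum-deg ⟨
        sum deg ≤⟨ sum-mono pointwise ⟩
        sum (λ x → [ X x ] * (64 * g) + ([ spare x ] * deg x + # (λ c → leaf c x) * deg x)) ≡⟨ sum-+₃ _ _ _ ⟩
        sum (λ x → [ X x ] * (64 * g)) + (weight spare + sum (λ x → # (λ c → leaf c x) * deg x))
          ≤⟨ +-mono-≤ (≤-reflexive (sum-[]* X (64 * g))) (+-mono-≤ spare-weight used-weight) ⟩
        # X * (64 * g) + (# Y * (32 * g) + # C * d + 2 * P) ∎
        where
        open ≤-Reasoning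
        pointwise : ∀ x → deg x ≤ [ X x ] * (64 * g) + ([ spare x ] * deg x + # (λ c → leaf c x) * deg x)
        pointwise x with bool (used x) | bool (64 * g ≤ᵈ deg x) | bool (X x)
        ... | inj₁ u | _ | _ = ≤-trans (≤-trans (≤[]* u) (*-monoˡ-≤ (deg x) (any≤# (λ c → leaf c x))))
              (≤-trans (m≤n+m _ ([ spare x ] * deg x)) (m≤n+m _ ([ X x ] * (64 * g))))
        ... | inj₂ u | inj₁ t | _ = ≤-trans (≤[]* (∧-intro t (not-false u))) (≤-trans (m≤m+n _ _) (m≤n+m _ ([ X x ] * (64 * g))))
        ... | inj₂ u | inj₂ f | inj₁ ∈X = ≤-trans (≤-trans (<⇒≤ (≤ᵈ-false f)) (≤[]* ∈X)) (m≤m+n _ _)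
        ... | inj₂ u | inj₂ f | inj₂ ∉X = ≤-trans (≤-reflexive (sum-zero λ y → cong [_] (¬true λ p → true≢false (e-X y x p) ∉X))) z≤n
        used-weight : sum (λ x → # (λ c → leaf c x) * deg x) ≤ 2 * P
        used-weight = begin
          sum (λ x → # (λ c → leaf c x) * deg x) ≡⟨ leaves-weight ⟨
          sum (λ c → weight (leaf c)) ≤⟨ sum-mono per-bag ⟩
          sum (λ c → 2 * ([ C c ] * # nb (leaf c))) ≡⟨ *-distribˡ-sum 2 _ ⟨
          2 * P ∎
          where
          per-bag : ∀ c → weight (leaf c) ≤ 2 * ([ C c ] * # nb (leaf c))
          per-bag c with bool (C c)
          ... | inj₁ t = ≤-trans (fresh c t) (*-monoʳ-≤ 2 (≤[]* t))
          ... | inj₂ f = ≤-trans (≤-reflexive (sum-zero λ x → cong (λ p → [ p ] * deg x) (¬true λ p → true≢false (leaf-C c x p) f))) z≤n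
        spare-weight : weight spare ≤ # Y * (32 * g) + # C * d
        spare-weight = begin
          weight spare ≡⟨ sum-weight spare ⟨
          sum (λ y → # (λ x → spare x ∧ e y x)) ≤⟨ sum-mono per-row ⟩
          sum (λ y → [ Y y ] * (32 * g) + [ C y ] * d) ≡⟨ sum-+ _ _ ⟩
          sum (λ y → [ Y y ] * (32 * g)) + sum (λ y → [ C y ] * d) ≡⟨ cong₂ _+_ (sum-[]* Y (32 * g)) (sum-[]* C d) ⟩
          # Y * (32 * g) + # C * d ∎
          where
          per-row : ∀ y → # (λ x → spare x ∧ e y x) ≤ [ Y y ] * (32 * g) + [ C y ] * d
          per-row y with bool (Y y) | bool (C y)
          ... | inj₂ ∉Y | _ = ≤-trans (≤-reflexive (sum-zero λ x → cong [_] (¬true λ p → true≢false (e-Y y x (∧-elimʳ {spare x} p)) ∉Y))) z≤n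
          ... | inj₁ ∈Y | inj₁ ∈C = ≤-trans (≤-trans (#-mono λ x → ∧-elimʳ {spare x}) (≤-trans (≤-reflexive (row y ∈Y)) (≤[]* ∈C))) (m≤n+m _ _)
          ... | inj₁ ∈Y | inj₂ ∉C = ≤-trans (≤-trans (#-mono λ x p → ∧-intro (∧-elimʳ {spare x} p) (∧-elimˡ p)) (≤-trans (<⇒≤ (maximal y ∈Y ∉C)) (≤[]* ∈Y))) (m≤m+n _ _)

      -- A centre sees at most `d` bags; any other vertex of `Y` sees at most `16 * g` plus its
      -- share of the potential.
      P≤h : P ≤ # C * d + (# Y * (16 * g) + h C)
      P≤h = begin
        P ≡⟨ double-count C (λ c y → nb (leaf c) y) ⟩
        sum (T C) ≤⟨ sum-mono pointwise ⟩
        sum (λ y → [ C y ] * d + ([ Y y ] * (16 * g) + [ not (C y) ] * (T C y ∸ 16 * g))) ≡⟨ sum-+₃ _ _ _ ⟩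
        sum (λ y → [ C y ] * d) + (sum (λ y → [ Y y ] * (16 * g)) + h C) ≡⟨ cong₂ (λ a c → a + (c + h C)) (sum-[]* C d) (sum-[]* Y (16 * g)) ⟩
        # C * d + (# Y * (16 * g) + h C) ∎
        where
        open ≤-Reasoning
        pointwise : ∀ y → T C y ≤ [ C y ] * d + ([ Y y ] * (16 * g) + [ not (C y) ] * (T C y ∸ 16 * g))
        pointwise y with bool (Y y) | bool (C y)
        ... | inj₂ ∉Y | _ = ≤-trans (T≤d C y) (≤-trans (≤-reflexive (cong (λ c → [ c ] * d) ∉Y)) z≤n)
        ... | inj₁ ∈Y | inj₁ ∈C = ≤-trans (≤-trans (≤-trans (T≤row C y) (≤-reflexive (row y ∈Y))) (≤[]* ∈C)) (m≤m+n _ _)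
        ... | inj₁ ∈Y | inj₂ ∉C = ≤-trans (≤-trans (m≤n+m∸n (T C y) (16 * g)) (+-mono-≤ (≤[]* {x = 16 * g} ∈Y) (≤[]* (not-false ∉C)))) (m≤n+m _ ([ C y ] * d))

      -- In units of `g * # Y`, the left side of `edges` is 256. Low degrees and spare rows take 64
      -- and 32, the truncation in `P≤h` takes twice 16, and the centres, at `768 * g` each, take at
      -- most 48 because `# C * 16` is at most `# Y`. The remaining 80 are covered by `2 * h C`.
      h-large : 40 * g * # Y ≤ h C
      h-large = *-cancelˡ-≤ 2 (linarith 0
        (+-mono-≤ (≤-trans edges (+-monoˡ-≤ _ (*-monoˡ-≤ (64 * g) #X≤#Y))) (+-mono-≤ (*-monoʳ-≤ 2 P≤h) (*-monoʳ-≤ (3 * (16 * g)) (≤-trans (*-monoʳ-≤ (# C) 16≤b) #C*b≤#Y))))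
        (trans (cong (λ d → 2 * (40 * g * # Y) + (# Y * (64 * g) + (# Y * (32 * g) + # C * d + 2 * P) + (2 * (# C * d + (# Y * (16 * g) + h C)) + 3 * (16 * g) * # Y)) + 0) d≡)
          (trans (identity g (# Y) (# C) P (h C)) (cong (λ d → 2 * h C + (# Y * d + (2 * P + 3 * (16 * g) * (# C * 16)))) (≡-sym d≡)))))
        where
        identity : ∀ g Y C P h → 2 * (40 * g * Y) + (Y * (64 * g) + (Y * (32 * g) + C * (256 * g) + 2 * P) + (2 * (C * (256 * g) + (Y * (16 * g) + h)) + 3 * (16 * g) * Y)) + 0
          ≡ 2 * h + (Y * (256 * g) + (2 * P + 3 * (16 * g) * (C * 16)))
        identity = solve-∀

      h-dense : 40 * g * b * # C ≤ h C
      h-dense = begin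
        40 * g * b * # C ≡⟨ identity (40 * g) b (# C) ⟩
        40 * g * (# C * b) ≤⟨ *-monoʳ-≤ (40 * g) #C*b≤#Y ⟩
        40 * g * # Y ≤⟨ h-large ⟩
        h C ∎
        where
        open ≤-Reasoning
        identity : ∀ a b c → a * b * c ≡ a * (c * b)
        identity = solve-∀

      h-positive : 0 < h C
      h-positive = begin
        1 * 1 ≤⟨ *-mono-≤ (≤-trans 1≤m (≤-trans m≤s'm (≤-trans s'm≤g (m≤m+n g _)))) Y-nonempty ⟩
        40 * g * # Y ≤⟨ h-large ⟩
        h C ∎
        where open ≤-Reasoning

    -- Attaching vertices to bags

    hits : Maybe V → V → Bool
    hits nothing L = false
    hits (just c) L = c == L

    hits-just : ∀ {mc L} → hits mc L ≡ true → mc ≡ just L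
    hits-just {just c} t = cong just (==-≡ t)

    module Attaching (𝓛 : V → Bool) where

      -- Arcs are directed: only vertices attached to `L` enlarge its out-neighbourhood.
      out : (V → Maybe V) → V → V → Bool
      out f L L′ = (𝓛 L′ ∧ not (L′ == L)) ∧ anyᵇ (λ y → hits (f y) L ∧ nb (leaf L′) y)

      arcs : (V → Maybe V) → ℕ
      arcs f = sum (λ L → # out f L)

      -- `f y ≡ just L` contracts `y` into the bag of `L`. The invariant `paid` says that the bags
      -- seen by attached vertices are, up to a factor two, matched by distinct arcs.
      record Attachment : Set where
        field
          f : V → Maybe V
          f-𝓛 : ∀ {y L} → f y ≡ just L → 𝓛 L ≡ true
          f-C : ∀ {y L} → f y ≡ just L → C y ≡ false
          f-nb : ∀ {y L} → f y ≡ just L → nb (leaf L) y ≡ true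
          paid : sum (λ y → [ is-just (f y) ] * T 𝓛 y) ≤ 2 * arcs f

      -- Among at least `16 * g` bags seen by `y`, only `L` itself and fewer than `8 * g` old
      -- out-neighbours give no new arc. So at least half of them do, which preserves `paid`.
      attach : (𝒜 : Attachment) → let open Attachment 𝒜 in ∀ y L → f y ≡ nothing → C y ≡ false → 𝓛 L ≡ true → nb (leaf L) y ≡ true →
        16 * g ≤ T 𝓛 y → # (λ L′ → out f L L′ ∧ nb (leaf L′) y) < 8 * g →
        Σ Attachment λ 𝒜′ → # (is-just ∘ Attachment.f 𝒜′) ≡ suc (# (is-just ∘ f))
      attach 𝒜 y L fy ∉C ∈𝓛 y∈nb T-big few-old = 𝒜′ , trans (sum-cong λ v → cong [_] (attached v)) (#-insert (is-just ∘ f) y (cong is-just fy))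
        where
        open Attachment 𝒜
        open ≤-Reasoning
        f′ : V → Maybe V
        f′ v = if v == y then just L else f v
        cases : ∀ v → (v ≡ y × f′ v ≡ just L) ⊎ (f′ v ≡ f v)
        cases v with v Fin.≟ y
        ... | yes eq = inj₁ (eq , refl)
        ... | no _ = inj₂ refl
        attached : ∀ v → is-just (f′ v) ≡ insert y (is-just ∘ f) v
        attached v with v Fin.≟ y
        ... | yes _ = refl
        ... | no _ = refl
        lift : (P : V → V → Set) → P y L → (∀ {v c} → f v ≡ just c → P v c) → ∀ {v c} → f′ v ≡ just c → P v c
        lift P new old {v} {c} eq with cases v
        lift P new old {v} {c} eq | inj₂ same = old (trans (≡-sym same) eq)
        lift P new old {v} {c} eq | inj₁ (refl , same) with trans (≡-sym same) eq
        ... | refl = new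
        f′y : f′ y ≡ just L
        f′y = cong (λ c → if c then just L else f y) (==-refl y)
        kept : ∀ v c → hits (f v) c ≡ true → hits (f′ v) c ≡ true
        kept v c t with cases v
        ... | inj₂ same = subst (λ mc → hits mc c ≡ true) (≡-sym same) t
        ... | inj₁ (refl , _) with trans (≡-sym fy) (hits-just {f v} {c} t)
        ...   | ()
        out-mono : ∀ c c′ → out f c c′ ≡ true → out f′ c c′ ≡ true
        out-mono c c′ t with any-elim _ (∧-elimʳ {𝓛 c′ ∧ not (c′ == c)} t)
        ... | v , t′ = ∧-intro (∧-elimˡ t) (any-intro _ v (∧-intro (kept v c (∧-elimˡ t′)) (∧-elimʳ {hits (f v) c} t′)))
        fresh-arc : V → Bool
        fresh-arc L′ = (𝓛 L′ ∧ nb (leaf L′) y) ∧ (not (L′ == L) ∧ not (out f L L′))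
        out-fresh : ∀ L′ → fresh-arc L′ ≡ true → out f′ L L′ ≡ true
        out-fresh L′ t = ∧-intro (∧-intro (∧-elimˡ {𝓛 L′} (∧-elimˡ t)) (∧-elimˡ {not (L′ == L)} (∧-elimʳ {𝓛 L′ ∧ nb (leaf L′) y} t)))
          (any-intro _ y (∧-intro (trans (cong (λ mc → hits mc L) f′y) (==-refl L)) (∧-elimʳ {𝓛 L′} (∧-elimˡ t))))
        grown : ∀ c → # out f c + [ c == L ] * # fresh-arc ≤ # out f′ c
        grown c with c Fin.≟ L
        ... | no _ = ≤-trans (≤-reflexive (+-identityʳ _)) (#-mono (out-mono c))
        ... | yes refl = ≤-trans (≤-reflexive (trans (cong (# out f c +_) (+-identityʳ (# fresh-arc))) (≡-sym (sum-+ _ _)))) (sum-mono pointwise)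
          where
          pointwise : ∀ L′ → [ out f c L′ ] + [ fresh-arc L′ ] ≤ [ out f′ c L′ ]
          pointwise L′ with bool (out f c L′)
          ... | inj₁ t = ≤-trans (≤-reflexive (cong₂ (λ p q → [ p ] + [ q ]) t (¬true λ t′ → true≢false t (not-true (∧-elimʳ {not (L′ == c)} (∧-elimʳ {𝓛 L′ ∧ nb (leaf L′) y} t′)))))) ([]-intro (out-mono c L′ t))
          ... | inj₂ t = ≤-trans (≤-reflexive (cong (λ p → [ p ] + [ fresh-arc L′ ]) t)) ([]-mono (out-fresh L′))
        arcs-grown : arcs f + # fresh-arc ≤ arcs f′
        arcs-grown = begin
          arcs f + # fresh-arc ≡⟨ cong (arcs f +_) (sum-singleton L (λ _ → # fresh-arc)) ⟨
          arcs f + sum (λ c → [ c == L ] * # fresh-arc) ≡⟨ sum-+ _ _ ⟨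
          sum (λ c → # out f c + [ c == L ] * # fresh-arc) ≤⟨ sum-mono grown ⟩
          arcs f′ ∎
        old : ℕ
        old = # (λ L′ → out f L L′ ∧ nb (leaf L′) y)
        T≤ : T 𝓛 y ≤ 1 + (old + # fresh-arc)
        T≤ = ≤-trans (sum-mono pointwise) (≤-reflexive (trans (sum-+₃ _ _ _) (cong (_+ (old + # fresh-arc)) (#-singleton L))))
          where
          pointwise : ∀ L′ → [ 𝓛 L′ ∧ nb (leaf L′) y ] ≤ [ L′ == L ] + ([ out f L L′ ∧ nb (leaf L′) y ] + [ fresh-arc L′ ])
          pointwise L′ with 𝓛 L′ ∧ nb (leaf L′) y in seen | L′ == L | out f L L′ in o
          ... | false | _ | _ = z≤n
          ... | true | true | _ = m≤m+n 1 _
          ... | true | false | true = ≤-trans ([]-intro (∧-elimʳ {𝓛 L′} seen)) (m≤m+n _ _)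
          ... | true | false | false = ≤-refl
        𝒜′ : Attachment
        𝒜′ = record
          { f = f′
          ; f-𝓛 = lift (λ _ c → 𝓛 c ≡ true) ∈𝓛 f-𝓛
          ; f-C = lift (λ v _ → C v ≡ false) ∉C f-C
          ; f-nb = lift (λ v c → nb (leaf c) v ≡ true) y∈nb f-nb
          ; paid = begin
              sum (λ v → [ is-just (f′ v) ] * T 𝓛 v) ≡⟨ sum-cong (λ v → cong (λ p → [ p ] * T 𝓛 v) (attached v)) ⟩
              sum (λ v → [ insert y (is-just ∘ f) v ] * T 𝓛 v) ≡⟨ sum-insert (is-just ∘ f) y (T 𝓛) (cong is-just fy) ⟩
              T 𝓛 y + sum (λ v → [ is-just (f v) ] * T 𝓛 v) ≤⟨ +-mono-≤ gain paid ⟩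
              2 * # fresh-arc + 2 * arcs f ≡⟨ identity (# fresh-arc) (arcs f) ⟩
              2 * (arcs f + # fresh-arc) ≤⟨ *-monoʳ-≤ 2 arcs-grown ⟩
              2 * arcs f′ ∎ }
          where
          identity : ∀ a b → 2 * a + 2 * b ≡ 2 * (b + a)
          identity = solve-∀
          -- The 1 that stands for `L` is covered by the strict bound on `old`: together they are at
          -- most `8 * g`, half of the lower bound on `T 𝓛 y`.
          gain : T 𝓛 y ≤ 2 * # fresh-arc
          gain = linarith 0 (+-mono-≤ (*-monoʳ-≤ 2 T≤) (+-mono-≤ T-big (*-monoʳ-≤ 2 few-old))) (balance (T 𝓛 y) (# fresh-arc) old g)
            where
            balance : ∀ t w o g → t + (2 * (1 + (o + w)) + (t + 2 * (8 * g))) + 0 ≡ 2 * w + (2 * t + (16 * g + 2 * suc o))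
            balance = solve-∀

      -- The situation in which `attach` no longer applies to any vertex and any bag.
      Stuck : (V → Maybe V) → Set
      Stuck f = ∀ y L → is-just (f y) ≡ false → C y ≡ false → 16 * g ≤ T 𝓛 y → 𝓛 L ≡ true → nb (leaf L) y ≡ true →
        8 * g ≤ # (λ L′ → out f L L′ ∧ nb (leaf L′) y)

      attach-all : Σ Attachment λ 𝒜 → Stuck (Attachment.f 𝒜)
      attach-all = descent (λ 𝒜 → n G ∸ # (is-just ∘ Attachment.f 𝒜)) next none
        where
        none : Attachment
        none = record { f = λ _ → nothing ; f-𝓛 = λ () ; f-C = λ () ; f-nb = λ () ; paid = ≤-trans (≤-reflexive (sum-zero λ _ → refl)) z≤n }
        next : ∀ 𝒜 → (Σ Attachment λ 𝒜 → Stuck (Attachment.f 𝒜)) ⊎ ∃ λ 𝒜′ → n G ∸ # (is-just ∘ Attachment.f 𝒜′) < n G ∸ # (is-just ∘ Attachment.f 𝒜)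
        next 𝒜 = go (search λ y → anyᵇ (candidate y))
          where
          open Attachment 𝒜
          old : V → V → ℕ
          old y L = # (λ L′ → out f L L′ ∧ nb (leaf L′) y)
          vertex-ok centre-ok candidate : V → V → Bool
          vertex-ok y _ = not (is-just (f y)) ∧ (not (C y) ∧ (16 * g ≤ᵈ T 𝓛 y))
          centre-ok y L = 𝓛 L ∧ nb (leaf L) y
          candidate y L = vertex-ok y L ∧ (centre-ok y L ∧ not (8 * g ≤ᵈ old y L))
          unattached : ∀ {y} → is-just (f y) ≡ false → f y ≡ nothing
          unattached {y} p with f y
          ... | nothing = refl
          go : (∃ λ y → anyᵇ (candidate y) ≡ true) ⊎ (∀ y → anyᵇ (candidate y) ≡ false) → _
          go (inj₁ (y , t)) with any-elim (candidate y) t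
          ... | L , t′ with attach 𝒜 y L (unattached (not-true (∧-elimˡ vok))) (not-true (∧-elimˡ (∧-elimʳ {not (is-just (f y))} vok)))
                  (∧-elimˡ cok) (∧-elimʳ {𝓛 L} cok) (≤ᵈ-true (∧-elimʳ {not (C y)} (∧-elimʳ {not (is-just (f y))} vok)))
                  (≤ᵈ-false (not-true (∧-elimʳ {centre-ok y L} (∧-elimʳ {vertex-ok y L} t′))))
            where
            vok = ∧-elimˡ {vertex-ok y L} t′
            cok = ∧-elimˡ {centre-ok y L} (∧-elimʳ {vertex-ok y L} t′)
          ... | 𝒜′ , size = inj₂ (𝒜′ , ∸-monoʳ-< (≤-reflexive (≡-sym size)) (#≤n (is-just ∘ Attachment.f 𝒜′)))
          go (inj₂ stop) = inj₁ (𝒜 , λ y L fy ∉C big ∈𝓛 y∈nb → enough y L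
            (∧-intro (not-false fy) (∧-intro (not-false ∉C) (≤ᵈ-intro big))) (∧-intro ∈𝓛 y∈nb))
            where
            enough : ∀ y L → vertex-ok y L ≡ true → centre-ok y L ≡ true → 8 * g ≤ old y L
            enough y L v c with bool (8 * g ≤ᵈ old y L)
            ... | inj₁ t = ≤ᵈ-true t
            ... | inj₂ t = true≢false (any-intro (candidate y) L (∧-intro v (∧-intro c (not-false t)))) (stop y)

      -- Saturated and unsaturated bags

      module Balance (𝓛⊆C : ∀ c → 𝓛 c ≡ true → C c ≡ true) (𝒜 : Attachment) (stuck-dense : Stuck (Attachment.f 𝒜)) where
        open Attachment 𝒜

        stuck : V → Bool
        stuck y = not (is-just (f y)) ∧ (not (C y) ∧ (16 * g ≤ᵈ T 𝓛 y))

        full : V → Bool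
        full L = b * m ≤ᵈ # out f L

        S U : V → Bool
        S L = 𝓛 L ∧ full L
        U L = 𝓛 L ∧ not (full L)

        -- `codegree-bound` with `z = x`, where `W` is the set of leaves of all out-neighbours of
        -- `L`. As `L` is unsaturated, `W` has at most `8 * b` times `b * m` elements. Each stuck
        -- neighbour of `x` sees `L` through `x`, hence sees at least `8 * g` of these
        -- out-neighbours.
        stuck-degree : ∀ L x → U L ≡ true → leaf L x ≡ true → # (λ y → stuck y ∧ e y x) ≤ m
        stuck-degree L x UL lf = *-cancelˡ-≤ s' {{>-nonZero 1≤s'}} (begin
          s' * # A ≤⟨ *-monoˡ-≤ (# A) s'≤s'ᵏ ⟩
          s' ^ k * # A ≡⟨ *-comm (s' ^ k) (# A) ⟩
          # A * s' ^ k ≤⟨ *-cancelʳ-≤ (# A * s' ^ k) (s' * m) ((8 * m) ^ k) {{m^n≢0 (8 * m) k {{>-nonZero 0<8m}}}} scaled ⟩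
          s' * m ∎)
          where
          open ≤-Reasoning
          A W : V → Bool
          A y = stuck y ∧ e y x
          W x′ = anyᵇ (λ L′ → out f L L′ ∧ leaf L′ x′)
          s'≤s'ᵏ : s' ≤ s' ^ k
          s'≤s'ᵏ = ≤-trans (≤-reflexive (≡-sym (^-identityʳ s'))) (^-monoʳ-≤ s' {{>-nonZero 1≤s'}} 1≤k)
          0<8m : 0 < 8 * m
          0<8m = ≤-trans 1≤m (m≤m+n m _)
          -- `out` excludes `L` itself, and `x` is a leaf of no other bag.
          x∉W : W x ≡ false
          x∉W = ¬true λ t → let L′ , t′ = any-elim _ t in
            true≢false (trans (cong (_== L) (leaf-unique L′ L x (∧-elimʳ {out f L L′} t′) lf)) (==-refl L))
              (not-true (∧-elimʳ {𝓛 L′} (∧-elimˡ {𝓛 L′ ∧ not (L′ == L)} (∧-elimˡ {out f L L′} t′))))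
          #W≤ : # W ≤ b * m * (8 * b)
          #W≤ = begin
            # W ≤⟨ sum-mono (λ x′ → any≤# (λ L′ → out f L L′ ∧ leaf L′ x′)) ⟩
            sum (λ x′ → # (λ L′ → out f L L′ ∧ leaf L′ x′)) ≡⟨ double-count (out f L) leaf ⟨
            sum (λ L′ → [ out f L L′ ] * # leaf L′) ≤⟨ sum-mono (λ L′ → []*-monoʳ (out f L L′) λ o → few L′ (𝓛⊆C L′ (∧-elimˡ {𝓛 L′} (∧-elimˡ o)))) ⟩
            sum (λ L′ → [ out f L L′ ] * (8 * b)) ≡⟨ sum-[]* (out f L) (8 * b) ⟩
            # out f L * (8 * b) ≤⟨ *-monoˡ-≤ (8 * b) (<⇒≤ (≤ᵈ-false (not-true (∧-elimʳ {𝓛 L} UL)))) ⟩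
            b * m * (8 * b) ∎
          crowded : ∀ a → A a ≡ true → 4 * g + k ≤ # (λ w → W w ∧ e a w)
          crowded a Aa = begin
            4 * g + k ≤⟨ +-monoʳ-≤ (4 * g) (≤-trans k≤g (m≤m+n g _)) ⟩
            4 * g + 4 * g ≡⟨ identity g ⟩
            8 * g ≤⟨ stuck-dense a L (not-true (∧-elimˡ sa)) (not-true (∧-elimˡ sa′)) (≤ᵈ-true (∧-elimʳ {not (C a)} sa′)) (∧-elimˡ UL)
                       (any-intro _ x (∧-intro lf (∧-elimʳ {stuck a} Aa))) ⟩
            -- Each bag is seen through one of its leaves, and disjointness makes these leaves
            -- distinct elements of `W`.
            # (λ L′ → out f L L′ ∧ nb (leaf L′) a) ≤⟨ sum-mono (λ L′ → []≤ (out f L L′ ∧ nb (leaf L′) a) (leaf-witness L′)) ⟩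
            sum (λ L′ → # (λ x′ → (out f L L′ ∧ leaf L′ x′) ∧ e a x′)) ≡⟨ sum-comm _ ⟩
            sum (λ x′ → # (λ L′ → (out f L L′ ∧ leaf L′ x′) ∧ e a x′)) ≤⟨ sum-mono (λ x′ → unique⇒#≤ (λ L′ → (out f L L′ ∧ leaf L′ x′) ∧ e a x′)
                (λ L′ t → ∧-intro (any-intro _ L′ (∧-elimˡ t)) (∧-elimʳ {out f L L′ ∧ leaf L′ x′} t))
                λ c c′ p q → leaf-unique c c′ x′ (∧-elimʳ {out f L c} (∧-elimˡ p)) (∧-elimʳ {out f L c′} (∧-elimˡ q))) ⟩
            # (λ w → W w ∧ e a w) ∎
            where
            identity : ∀ g → 4 * g + 4 * g ≡ 8 * g
            identity = solve-∀
            sa = ∧-elimˡ {stuck a} Aa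
            sa′ = ∧-elimʳ {not (is-just (f a))} sa
            leaf-witness : ∀ L′ → out f L L′ ∧ nb (leaf L′) a ≡ true → 1 ≤ # (λ x′ → (out f L L′ ∧ leaf L′ x′) ∧ e a x′)
            leaf-witness L′ t with any-elim _ (∧-elimʳ {out f L L′} t)
            ... | x′ , t′ = ≤-trans ([]-intro (∧-intro (∧-intro (∧-elimˡ {out f L L′} t) (∧-elimˡ {leaf L′ x′} t′)) (∧-elimʳ {leaf L′ x′} t′))) (term≤sum _ x′)
          scaled : # A * s' ^ k * (8 * m) ^ k ≤ s' * m * (8 * m) ^ k
          scaled = begin
            # A * s' ^ k * (8 * m) ^ k ≡⟨ *-assoc (# A) _ _ ⟩
            # A * (s' ^ k * (8 * m) ^ k) ≡⟨ cong (# A *_) (^-distribʳ-* k s' (8 * m)) ⟨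
            -- The threshold `4 * g` is `s' * (8 * m)`. The resulting factor `s' ^ k` compensates
            -- the `s'` in the count, since `k` is positive.
            # A * (s' * (8 * m)) ^ k ≡⟨ cong (λ v → # A * v ^ k) (trans (identity s' m) (cong (4 *_) (≡-sym g≡))) ⟩
            # A * (4 * g) ^ k ≤⟨ codegree-bound G k s' free e x A W (4 * g) e-adj (λ a t → e-adj a x (∧-elimʳ {stuck a} t)) x∉W crowded ⟩
            s' * # W ^ k ≤⟨ *-monoʳ-≤ s' (^-monoˡ-≤ k #W≤) ⟩
            s' * (b * m * (8 * b)) ^ k ≡⟨ cong (λ v → s' * v ^ k) (identity′ b m) ⟩
            s' * (b * b * (8 * m)) ^ k ≡⟨ cong (s' *_) (trans (^-distribʳ-* k (b * b) (8 * m)) (cong (_* (8 * m) ^ k) (^-distribʳ-* k b b))) ⟩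
            s' * (b ^ k * b ^ k * (8 * m) ^ k) ≤⟨ *-monoʳ-≤ s' (*-monoˡ-≤ ((8 * m) ^ k) b²ᵏ≤m) ⟩
            s' * (m * (8 * m) ^ k) ≡⟨ *-assoc s' m _ ⟨
            s' * m * (8 * m) ^ k ∎
            where
            identity : ∀ s m → s * (8 * m) ≡ 4 * (2 * (s * m))
            identity = solve-∀
            identity′ : ∀ b m → b * m * (8 * b) ≡ b * b * (8 * m)
            identity′ = solve-∀

        u : V → ℕ
        u y = # (λ L → U L ∧ nb (leaf L) y)

        T-split : ∀ y → T 𝓛 y ≡ T S y + u y
        T-split y = trans (sum-cong λ L → pointwise (𝓛 L) (full L) (nb (leaf L) y)) (sum-+ _ _)
          where
          pointwise : ∀ l s t → [ l ∧ t ] ≡ [ (l ∧ s) ∧ t ] + [ (l ∧ not s) ∧ t ]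
          pointwise false s t = refl
          pointwise true true t = ≡-sym (+-identityʳ _)
          pointwise true false t = refl

        -- An unsaturated bag has at most `8 * b` leaves, and each leaf has at most `m` stuck
        -- neighbours.
        stuck-total : sum (λ y → [ stuck y ] * u y) ≤ # 𝓛 * (8 * b * m)
        stuck-total = begin
          sum (λ y → [ stuck y ] * u y) ≡⟨ double-count stuck (λ y L → U L ∧ nb (leaf L) y) ⟩
          sum (λ L → # (λ y → stuck y ∧ (U L ∧ nb (leaf L) y))) ≤⟨ sum-mono (λ L → ≤-trans (sum-mono (pointwise L)) (≤-reflexive (≡-sym (*-distribˡ-sum [ U L ] _)))) ⟩
          sum (λ L → [ U L ] * sum (λ y → # (λ x → leaf L x ∧ (stuck y ∧ e y x)))) ≤⟨ sum-mono (λ L → []*-monoʳ (U L) (per-bag L)) ⟩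
          sum (λ L → [ U L ] * (8 * b * m)) ≡⟨ sum-[]* U (8 * b * m) ⟩
          # U * (8 * b * m) ≤⟨ *-monoˡ-≤ (8 * b * m) (#-mono {p = U} λ L → ∧-elimˡ) ⟩
          # 𝓛 * (8 * b * m) ∎
          where
          open ≤-Reasoning
          pointwise : ∀ L y → [ stuck y ∧ (U L ∧ nb (leaf L) y) ] ≤ [ U L ] * # (λ x → leaf L x ∧ (stuck y ∧ e y x))
          pointwise L y = []≤ _ λ t → let x , t′ = any-elim _ (∧-elimʳ {U L} (∧-elimʳ {stuck y} t)) in
            ≤-trans (≤-trans ([]-intro (∧-intro (∧-elimˡ {leaf L x} t′) (∧-intro (∧-elimˡ {stuck y} t) (∧-elimʳ {leaf L x} t′)))) (term≤sum _ x))
              (≤[]* {U L} (∧-elimˡ (∧-elimʳ {stuck y} t)))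
          per-bag : ∀ L → U L ≡ true → sum (λ y → # (λ x → leaf L x ∧ (stuck y ∧ e y x))) ≤ 8 * b * m
          per-bag L UL = begin
            sum (λ y → # (λ x → leaf L x ∧ (stuck y ∧ e y x))) ≡⟨ double-count (leaf L) (λ x y → stuck y ∧ e y x) ⟨
            sum (λ x → [ leaf L x ] * # (λ y → stuck y ∧ e y x)) ≤⟨ sum-mono (λ x → []*-monoʳ (leaf L x) (stuck-degree L x UL)) ⟩
            sum (λ x → [ leaf L x ] * m) ≡⟨ sum-[]* (leaf L) m ⟩
            # leaf L * m ≤⟨ *-monoˡ-≤ m (few L (𝓛⊆C L (∧-elimˡ UL))) ⟩
            8 * b * m ∎

        -- A non-centre that reaches the threshold is either attached and charged for all bags it
        -- sees, or stuck and charged for the unsaturated ones. Dropping the unsaturated bags lowers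
        -- its excess by at most their number.
        h-drop : h 𝓛 ≤ h S + (sum (λ y → [ is-just (f y) ] * T 𝓛 y) + sum (λ y → [ stuck y ] * u y))
        h-drop = ≤-trans (sum-mono pointwise) (≤-reflexive (sum-+₃ _ _ _))
          where
          open ≤-Reasoning
          u≤T : ∀ y → u y ≤ T 𝓛 y
          u≤T y = ≤-trans (m≤n+m (u y) (T S y)) (≤-reflexive (≡-sym (T-split y)))
          pointwise : ∀ y → [ not (C y) ] * (T 𝓛 y ∸ 16 * g) ≤
            [ not (C y) ] * (T S y ∸ 16 * g) + ([ is-just (f y) ] * T 𝓛 y + [ stuck y ] * u y)
          pointwise y = []*≤ (not (C y)) λ ∉C → ≤-trans (drop ∉C) (+-monoˡ-≤ _ (≤[]* ∉C))
            where
            charge : not (C y) ≡ true → 16 * g ≤ T 𝓛 y → u y ≤ [ is-just (f y) ] * T 𝓛 y + [ stuck y ] * u y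
            charge ∉C big with bool (is-just (f y))
            ... | inj₁ t = ≤-trans (≤-trans (u≤T y) (≤[]* t)) (m≤m+n _ _)
            ... | inj₂ t = ≤-trans (≤[]* (∧-intro (not-false t) (∧-intro ∉C (≤ᵈ-intro big)))) (m≤n+m _ ([ is-just (f y) ] * T 𝓛 y))
            drop : not (C y) ≡ true → T 𝓛 y ∸ 16 * g ≤ (T S y ∸ 16 * g) + ([ is-just (f y) ] * T 𝓛 y + [ stuck y ] * u y)
            drop ∉C with ≤-total (16 * g) (T 𝓛 y)
            ... | inj₂ small = ≤-trans (≤-reflexive (m≤n⇒m∸n≡0 small)) z≤n
            ... | inj₁ big = ≤-trans (m≤n+o⇒m∸n≤o (T 𝓛 y) (16 * g) (begin
              T 𝓛 y ≡⟨ T-split y ⟩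
              T S y + u y ≤⟨ +-monoˡ-≤ (u y) (m≤n+m∸n (T S y) (16 * g)) ⟩
              16 * g + (T S y ∸ 16 * g) + u y ≡⟨ +-assoc (16 * g) _ _ ⟩
              16 * g + ((T S y ∸ 16 * g) + u y) ∎)) (+-monoʳ-≤ (T S y ∸ 16 * g) (charge ∉C big))

        many-full : # 𝓛 ≤ 2 * # S → # 𝓛 * (b * m) ≤ 2 * arcs f
        many-full le = begin
          # 𝓛 * (b * m) ≤⟨ *-monoˡ-≤ (b * m) le ⟩
          2 * # S * (b * m) ≡⟨ *-assoc 2 (# S) (b * m) ⟩
          2 * (# S * (b * m)) ≡⟨ cong (2 *_) (sum-[]* S (b * m)) ⟨
          2 * sum (λ L → [ S L ] * (b * m)) ≤⟨ *-monoʳ-≤ 2 (sum-mono λ L → []*≤ (S L) λ t → ≤ᵈ-true (∧-elimʳ {𝓛 L} t)) ⟩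
          2 * arcs f ∎
          where open ≤-Reasoning

        -- Doubling `h-drop` and inserting `light`, `paid` and `stuck-total` gives
        -- `h 𝓛 ≤ 4 * arcs f + 16 * (b * m) * # 𝓛`. By density and `m ≤ g` the left side is at least
        -- `40 * (b * m) * # 𝓛`, which leaves 24 where two suffice.
        light-full : 40 * g * b * # 𝓛 ≤ h 𝓛 → 2 * h S ≤ h 𝓛 → # 𝓛 * (b * m) ≤ 2 * arcs f
        light-full dense light = *-cancelˡ-≤ 2 (≤-trans (m≤m+n _ (22 * (# 𝓛 * (b * m)))) (linarith 0
          (+-mono-≤ (+-mono-≤ (*-monoʳ-≤ 40 (*-monoˡ-≤ (# 𝓛) (*-monoˡ-≤ b (≤-trans m≤s'm s'm≤g)))) (≤-trans (≤-reflexive (reassoc g b (# 𝓛))) dense))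
            (+-mono-≤ (+-mono-≤ (*-monoʳ-≤ 2 h-drop) light) (+-mono-≤ (*-monoʳ-≤ 2 paid) (*-monoʳ-≤ 2 stuck-total))))
          (balance m b g (# 𝓛) (h 𝓛) (h S) attached stuck-sum (arcs f))))
          where
          attached = sum (λ y → [ is-just (f y) ] * T 𝓛 y)
          stuck-sum = sum (λ y → [ stuck y ] * u y)
          reassoc : ∀ g b l → 40 * (g * b * l) ≡ 40 * g * b * l
          reassoc = solve-∀
          balance : ∀ m b g l hl hs a t o →
            2 * (l * (b * m)) + 22 * (l * (b * m)) + ((40 * (g * b * l) + hl) + ((2 * (hs + (a + t)) + hl) + (2 * (2 * o) + 2 * (l * (8 * b * m))))) + 0
              ≡ 2 * (2 * o) + ((40 * (m * b * l) + 40 * (g * b * l)) + ((2 * hl + 2 * hs) + (2 * a + 2 * t)))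
          balance = solve-∀

    -- Passing to saturated bags and contracting

    record Outcome : Set where
      field
        𝓛 : V → Bool
        𝓛⊆C : ∀ c → 𝓛 c ≡ true → C c ≡ true
        nonempty : 0 < # 𝓛
        𝒜 : Attaching.Attachment 𝓛
        many-arcs : # 𝓛 * (b * m) ≤ 2 * Attaching.arcs 𝓛 (Attaching.Attachment.f 𝒜)

    record DenseFamily : Set where
      field
        𝓛 : V → Bool
        𝓛⊆C : ∀ c → 𝓛 c ≡ true → C c ≡ true
        dense : 40 * g * b * # 𝓛 ≤ h 𝓛
        positive : 0 < h 𝓛

    -- Positive potential thus forces a nonempty family, and so a minor with a vertex.
    h-empty : ∀ 𝓛 → # 𝓛 ≡ 0 → h 𝓛 ≡ 0
    h-empty 𝓛 none = sum-zero λ y → trans (cong ([ not (C y) ] *_) (m≤n⇒m∸n≡0 {T 𝓛 y} {16 * g} (≤-trans (≤-trans (#-mono {q = 𝓛} λ c → ∧-elimˡ) (≤-reflexive none)) z≤n))) (*-zeroʳ [ not (C y) ])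

    -- If neither alternative for the saturated bags S settles the matter, S is a smaller family that is still dense.
    outcome : DenseFamily → Outcome
    outcome = descent (λ F → # DenseFamily.𝓛 F) next
      where
      next : ∀ F → Outcome ⊎ ∃ λ F′ → # DenseFamily.𝓛 F′ < # DenseFamily.𝓛 F
      -- Attachment starts afresh for every family, since thresholds and arcs refer to the bags of
      -- that family only.
      next F with Attaching.attach-all (DenseFamily.𝓛 F)
      ... | 𝒜 , stuck-dense = conclude
        where
        open DenseFamily F
        open Attaching.Balance 𝓛 𝓛⊆C 𝒜 stuck-dense
        nonempty : 0 < # 𝓛
        nonempty = n≢0⇒n>0 λ none → <-irrefl (≡-sym (h-empty 𝓛 none)) positive
        done : # 𝓛 * (b * m) ≤ 2 * Attaching.arcs 𝓛 (Attaching.Attachment.f 𝒜) → Outcome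
        done many = record { 𝓛 = 𝓛 ; 𝓛⊆C = 𝓛⊆C ; nonempty = nonempty ; 𝒜 = 𝒜 ; many-arcs = many }
        conclude : Outcome ⊎ ∃ λ F′ → # DenseFamily.𝓛 F′ < # 𝓛
        conclude with # 𝓛 ≤? 2 * # S | 2 * h S ≤? h 𝓛
        ... | yes many | _ = inj₁ (done (many-full many))
        ... | no _ | yes light = inj₁ (done (light-full dense light))
        ... | no ¬many | no ¬light = inj₂ (F′ , ≤-<-trans (m≤m+n _ _) (≰⇒> ¬many))
          where
          heavy : h 𝓛 < 2 * h S
          heavy = ≰⇒> ¬light
          F′ : DenseFamily
          F′ = record
            { 𝓛 = S ; 𝓛⊆C = λ c t → 𝓛⊆C c (∧-elimˡ t)
            -- `S` has fewer than half of the bags but more than half of the potential, so the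
            -- potential per bag does not fall.
            ; dense = *-cancelˡ-≤ 2 (begin
                2 * (40 * g * b * # S) ≡⟨ swap (40 * g * b) (# S) ⟩
                40 * g * b * (2 * # S) ≤⟨ *-monoʳ-≤ (40 * g * b) (<⇒≤ (≰⇒> ¬many)) ⟩
                40 * g * b * # 𝓛 ≤⟨ dense ⟩
                h 𝓛 ≤⟨ <⇒≤ heavy ⟩
                2 * h S ∎)
            ; positive = *-cancelˡ-< 2 0 (h S) (≤-<-trans z≤n heavy) }
            where
            open ≤-Reasoning
            swap : ∀ a c → 2 * (a * c) ≡ a * (2 * c)
            swap = solve-∀

    -- A branch set consists of a centre, its leaves and the vertices attached to it. These sets are
    -- disjoint: leaves lie in `X`, centres and attached vertices in `Y`, and no centre is attached.
    -- An arc is realised by an edge from an attached vertex to a leaf of the other bag.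
    contracted : Outcome → Σ Graph λ Γ → 0 < n Γ × IsMinor Γ G × n Γ * (b * m) ≤ 2 * degSum Γ
    contracted O = finish (contract G 𝓛 member (λ L L′ → 𝓛 L ∧ out f L L′) root unique path arc-irrefl realise)
      where
      open Outcome O
      open Attaching 𝓛
      open Attachment 𝒜
      open ≤-Reasoning
      member : V → V → Bool
      member L v = (v == L) ∨ (leaf L v ∨ hits (f v) L)
      Member : V → V → Set
      Member L v = v ≡ L ⊎ (leaf L v ≡ true ⊎ f v ≡ just L)
      member-elim : ∀ {L v} → member L v ≡ true → Member L v
      member-elim {L} {v} t with ∨-elim {v == L} t
      ... | inj₁ p = inj₁ (==-≡ p)
      ... | inj₂ p with ∨-elim {leaf L v} p
      ... | inj₁ q = inj₂ (inj₁ q)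
      ... | inj₂ q = inj₂ (inj₂ (hits-just q))
      member-intro : ∀ {L v} → Member L v → member L v ≡ true
      member-intro {L} (inj₁ refl) = ∨-introˡ (==-refl L)
      member-intro {L} {v} (inj₂ (inj₁ p)) = ∨-introʳ {v == L} (∨-introˡ p)
      member-intro {L} {v} (inj₂ (inj₂ p)) = ∨-introʳ {v == L} (∨-introʳ {leaf L v} (trans (cong (λ c → hits c L) p) (==-refl L)))
      root : ∀ L → 𝓛 L ≡ true → member L L ≡ true
      root L _ = member-intro {L} (inj₁ refl)
      centre∉X : ∀ {L} → 𝓛 L ≡ true → X L ≡ true → {A : Set} → A
      centre∉X {L} ∈𝓛 ∈X = true≢false (C-Y L (𝓛⊆C L ∈𝓛)) (disjoint L ∈X)
      attached∉X : ∀ {L v} → f v ≡ just L → X v ≡ true → {A : Set} → A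
      attached∉X {L} {v} fv ∈X = let x , t = any-elim _ (f-nb fv) in true≢false (e-Y v x (∧-elimʳ {leaf L x} t)) (disjoint v ∈X)
      leaf-X : ∀ {L v} → leaf L v ≡ true → X v ≡ true
      leaf-X {L} {v} lf = e-X L v (leaf-e L v lf)
      unique′ : ∀ L L′ v → 𝓛 L ≡ true → 𝓛 L′ ≡ true → Member L v → Member L′ v → L ≡ L′
      unique′ L L′ v l l′ (inj₁ refl) (inj₁ refl) = refl
      unique′ L L′ v l l′ (inj₁ refl) (inj₂ (inj₁ lf)) = centre∉X l (leaf-X lf)
      unique′ L L′ v l l′ (inj₁ refl) (inj₂ (inj₂ fv)) = true≢false (𝓛⊆C L l) (f-C fv)
      unique′ L L′ v l l′ (inj₂ (inj₁ lf)) (inj₁ refl) = centre∉X l′ (leaf-X lf)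
      unique′ L L′ v l l′ (inj₂ (inj₁ lf)) (inj₂ (inj₁ lf′)) = leaf-unique L L′ v lf lf′
      unique′ L L′ v l l′ (inj₂ (inj₁ lf)) (inj₂ (inj₂ fv)) = attached∉X fv (leaf-X lf)
      unique′ L L′ v l l′ (inj₂ (inj₂ fv)) (inj₁ refl) = true≢false (𝓛⊆C L′ l′) (f-C fv)
      unique′ L L′ v l l′ (inj₂ (inj₂ fv)) (inj₂ (inj₁ lf)) = attached∉X fv (leaf-X lf)
      unique′ L L′ v l l′ (inj₂ (inj₂ fv)) (inj₂ (inj₂ fv′)) = just-injective (trans (≡-sym fv) fv′)
      unique : ∀ L L′ v → 𝓛 L ≡ true → 𝓛 L′ ≡ true → member L v ≡ true → member L′ v ≡ true → L ≡ L′
      unique L L′ v l l′ t t′ = unique′ L L′ v l l′ (member-elim t) (member-elim t′)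
      leaf-path : ∀ {L v} → leaf L v ≡ true → WalkIn G (λ z → member L z ≡ true) v L
      leaf-path {L} {v} lf = step (member-intro (inj₂ (inj₁ lf))) (trans (Graph.sym G v L) (e-adj L v (leaf-e L v lf))) (here (member-intro {L} (inj₁ refl)))
      path′ : ∀ L v → Member L v → WalkIn G (λ z → member L z ≡ true) v L
      path′ L v (inj₁ refl) = here (member-intro {L} (inj₁ refl))
      path′ L v (inj₂ (inj₁ lf)) = leaf-path lf
      path′ L v (inj₂ (inj₂ fv)) = let x , t = any-elim _ (f-nb fv) in
        step (member-intro (inj₂ (inj₂ fv))) (e-adj v x (∧-elimʳ {leaf L x} t)) (leaf-path (∧-elimˡ t))
      path : ∀ L v → 𝓛 L ≡ true → member L v ≡ true → WalkIn G (λ z → member L z ≡ true) v L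
      path L v _ t = path′ L v (member-elim t)
      arc-irrefl : ∀ L → 𝓛 L ∧ out f L L ≡ false
      arc-irrefl L = ¬true λ t → true≢false (==-refl L) (not-true (∧-elimʳ {𝓛 L} (∧-elimˡ {𝓛 L ∧ not (L == L)} (∧-elimʳ {𝓛 L} t))))
      realise : ∀ L L′ → 𝓛 L ∧ out f L L′ ≡ true → ∃ λ x → ∃ λ y → member L x ≡ true × member L′ y ≡ true × adj G x y ≡ true
      realise L L′ t with any-elim _ (∧-elimʳ {𝓛 L′ ∧ not (L′ == L)} (∧-elimʳ {𝓛 L} t))
      ... | y , t′ with any-elim _ (∧-elimʳ {hits (f y) L} t′)
      ... | x , t″ = y , x , member-intro (inj₂ (inj₂ (hits-just (∧-elimˡ t′)))) , member-intro (inj₂ (inj₁ (∧-elimˡ {leaf L′ x} t″))) , e-adj y x (∧-elimʳ {leaf L′ x} t″)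
      arcs≤ : arcs f ≤ sum (λ L → [ 𝓛 L ] * # (λ L′ → 𝓛 L′ ∧ (𝓛 L ∧ out f L L′)))
      arcs≤ = sum-mono pointwise
        where
        pointwise : ∀ L → # out f L ≤ [ 𝓛 L ] * # (λ L′ → 𝓛 L′ ∧ (𝓛 L ∧ out f L L′))
        pointwise L with bool (𝓛 L)
        ... | inj₁ l = ≤-trans (#-mono λ L′ t → ∧-intro (∧-elimˡ {𝓛 L′} (∧-elimˡ t)) (∧-intro l t)) (≤[]* l)
        -- `f` takes values in `𝓛` only, so no arc leaves any other vertex.
        ... | inj₂ l = ≤-trans (≤-reflexive (sum-zero λ L′ → cong [_] (¬true λ t → let y , t′ = any-elim _ (∧-elimʳ {𝓛 L′ ∧ not (L′ == L)} t) in
          true≢false (f-𝓛 (hits-just {f y} {L} (∧-elimˡ t′))) l))) z≤n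
      finish : (Σ Graph λ Γ → n Γ ≡ # 𝓛 × IsMinor Γ G × sum (λ L → [ 𝓛 L ] * # (λ L′ → 𝓛 L′ ∧ (𝓛 L ∧ out f L L′))) ≤ degSum Γ) →
        Σ Graph λ Γ → 0 < n Γ × IsMinor Γ G × n Γ * (b * m) ≤ 2 * degSum Γ
      finish (Γ , size , minor , le) = Γ , subst (0 <_) (≡-sym size) nonempty , minor , (begin
        n Γ * (b * m) ≡⟨ cong (_* (b * m)) size ⟩
        # 𝓛 * (b * m) ≤⟨ many-arcs ⟩
        2 * arcs f ≤⟨ *-monoʳ-≤ 2 (≤-trans arcs≤ le) ⟩
        2 * degSum Γ ∎)

  dense-minor : Σ Graph λ Γ → 0 < n Γ × IsMinor Γ G × n Γ * (b * m) ≤ 2 * degSum Γ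
  dense-minor = let B , maximal = maximal-bags in Accounting.contracted B (Accounting.outcome B (record
    { 𝓛 = Bags.C B ; 𝓛⊆C = λ _ t → t ; dense = Accounting.h-dense B maximal ; positive = Accounting.h-positive B maximal }))

-- Rational powers

/-mono : ∀ a n b m → a * suc m ≤ b * suc n → (pos a /ℚ suc n) ≤ℚ (pos b /ℚ suc m)
/-mono a n b m h = ℚₚ.toℚᵘ-cancel-≤ (ℚᵘₚ.≤-respʳ-≃ (ℚᵘₚ.≃-sym (ℚₚ.toℚᵘ-fromℚᵘ (mkℚᵘ (pos b) m)))
  (ℚᵘₚ.≤-respˡ-≃ (ℚᵘₚ.≃-sym (ℚₚ.toℚᵘ-fromℚᵘ (mkℚᵘ (pos a) n)))
    (*≤* (subst (ℤ._≤ (pos b ℤ.* pos (suc n))) (ℤₚ.pos-* a (suc m)) (subst (pos (a * suc m) ℤ.≤_) (ℤₚ.pos-* b (suc n)) (ℤ.+≤+ h))))))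

/-* : ∀ a n b m → (pos a /ℚ suc n) *ℚ (pos b /ℚ suc m) ≡ pos (a * b) /ℚ (suc n * suc m)
/-* a n b m = trans (ℚₚ.toℚᵘ-injective (ℚᵘₚ.≃-trans (ℚₚ.toℚᵘ-homo-* (pos a /ℚ suc n) (pos b /ℚ suc m))
  (ℚᵘₚ.≃-trans (ℚᵘₚ.*-cong (ℚₚ.toℚᵘ-fromℚᵘ (mkℚᵘ (pos a) n)) (ℚₚ.toℚᵘ-fromℚᵘ (mkℚᵘ (pos b) m)))
    (ℚᵘₚ.≃-sym (ℚₚ.toℚᵘ-fromℚᵘ _))))) (cong (_/ℚ (suc n * suc m)) (≡-sym (ℤₚ.pos-* a b)))

ι : ℕ → ℚ
ι a = pos a /ℚ 1

ι-* : ∀ a b → ι a *ℚ ι b ≡ ι (a * b)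
ι-* a b = /-* a 0 b 0

ι-mono : ∀ {a b} → a ≤ b → ι a ≤ℚ ι b
ι-mono {a} {b} h = /-mono a 0 b 0 (*-monoˡ-≤ 1 h)

/-nonNeg : ∀ a n .{{_ : NonZero n}} → NonNegativeℚ (pos a /ℚ n)
/-nonNeg a n = ℚₚ.normalize-nonNeg a n

^ℚ-nonNeg : ∀ x → NonNegativeℚ x → ∀ k → NonNegativeℚ (x ^ℚ k)
^ℚ-nonNeg x x≥0 zero = _
^ℚ-nonNeg x x≥0 (suc k) = ℚₚ.nonNeg*nonNeg⇒nonNeg x {{x≥0}} (x ^ℚ k) {{^ℚ-nonNeg x x≥0 k}}

^ℚ-mono : ∀ {x y} → NonNegativeℚ x → NonNegativeℚ y → x ≤ℚ y → ∀ k → (x ^ℚ k) ≤ℚ (y ^ℚ k)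
^ℚ-mono x≥0 y≥0 h zero = ℚₚ.≤-refl
^ℚ-mono {x} {y} x≥0 y≥0 h (suc k) = ℚₚ.≤-trans (ℚₚ.*-monoˡ-≤-nonNeg x {{x≥0}} (^ℚ-mono x≥0 y≥0 h k))
  (ℚₚ.*-monoʳ-≤-nonNeg (y ^ℚ k) {{^ℚ-nonNeg y y≥0 k}} h)

^ℚ-distrib-* : ∀ x y k → (x *ℚ y) ^ℚ k ≡ (x ^ℚ k) *ℚ (y ^ℚ k)
^ℚ-distrib-* x y zero = refl
^ℚ-distrib-* x y (suc k) = trans (cong ((x *ℚ y) *ℚ_) (^ℚ-distrib-* x y k)) (begin
  (x *ℚ y) *ℚ (x ^ℚ k *ℚ y ^ℚ k) ≡⟨ ℚₚ.*-assoc x y _ ⟩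
  x *ℚ (y *ℚ (x ^ℚ k *ℚ y ^ℚ k)) ≡⟨ cong (x *ℚ_) (trans (≡-sym (ℚₚ.*-assoc y _ _)) (cong (_*ℚ (y ^ℚ k)) (ℚₚ.*-comm y (x ^ℚ k)))) ⟩
  x *ℚ (x ^ℚ k *ℚ y *ℚ y ^ℚ k) ≡⟨ cong (x *ℚ_) (ℚₚ.*-assoc (x ^ℚ k) y (y ^ℚ k)) ⟩
  x *ℚ (x ^ℚ k *ℚ (y *ℚ y ^ℚ k)) ≡⟨ ℚₚ.*-assoc x _ _ ⟨
  (x *ℚ x ^ℚ k) *ℚ (y *ℚ y ^ℚ k) ∎)
  where open ≡-Reasoning

ι-^ : ∀ a k → ι a ^ℚ k ≡ ι (a ^ k)
ι-^ a zero = refl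
ι-^ a (suc k) = trans (cong (ι a *ℚ_) (ι-^ a k)) (ι-* a (a ^ k))

1^ℚ : ∀ k → 1ℚ ^ℚ k ≡ 1ℚ
1^ℚ zero = refl
1^ℚ (suc k) = trans (ℚₚ.*-identityˡ _) (1^ℚ k)

inverse-ι : ∀ c → (pos 1 /ℚ suc c) *ℚ ι (suc c) ≡ 1ℚ
inverse-ι c = trans (/-* 1 c (suc c) 0) (ℚₚ.fromℚᵘ-cong {mkℚᵘ (pos (1 * suc c)) (c * 1)} {mkℚᵘ (pos 1) 0}
  (*≡* (trans (≡-sym (ℤₚ.pos-* (1 * suc c) 1)) (trans (cong pos (identity c)) (ℤₚ.pos-* 1 (suc (c * 1)))))))
  where
  identity : ∀ c → 1 * suc c * 1 ≡ 1 * suc (c * 1)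
  identity = solve-∀

-- Transfers the comparison to natural numbers: `A` bounds `x` from above, `B` bounds a multiple of
-- `y` from below, and the factors `suc c` cancel in the `q`-th power.
power-bound : ∀ c q x y A B → NonNegativeℚ x → NonNegativeℚ y → x ≤ℚ ι A → A ^ suc q ≤ B ^ q → ι B ≤ℚ ι (suc c) *ℚ y →
  ((pos 1 /ℚ suc c) ^ℚ q) *ℚ (x ^ℚ suc q) ≤ℚ (y ^ℚ q)
power-bound c q x y A B x≥0 y≥0 x≤A A≤B B≤y = begin
  (γ ^ℚ q) *ℚ (x ^ℚ suc q) ≤⟨ mono (^ℚ-mono x≥0 (/-nonNeg A 1) x≤A (suc q)) ⟩
  (γ ^ℚ q) *ℚ (ι A ^ℚ suc q) ≡⟨ cong ((γ ^ℚ q) *ℚ_) (ι-^ A (suc q)) ⟩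
  (γ ^ℚ q) *ℚ ι (A ^ suc q) ≤⟨ mono (ι-mono A≤B) ⟩
  (γ ^ℚ q) *ℚ ι (B ^ q) ≡⟨ cong ((γ ^ℚ q) *ℚ_) (ι-^ B q) ⟨
  (γ ^ℚ q) *ℚ (ι B ^ℚ q) ≤⟨ mono (^ℚ-mono (/-nonNeg B 1) (ℚₚ.nonNeg*nonNeg⇒nonNeg (ι (suc c)) {{/-nonNeg (suc c) 1}} y {{y≥0}}) B≤y q) ⟩
  (γ ^ℚ q) *ℚ ((ι (suc c) *ℚ y) ^ℚ q) ≡⟨ ^ℚ-distrib-* γ _ q ⟨
  (γ *ℚ (ι (suc c) *ℚ y)) ^ℚ q ≡⟨ cong (_^ℚ q) (trans (≡-sym (ℚₚ.*-assoc γ _ y)) (trans (cong (_*ℚ y) (inverse-ι c)) (ℚₚ.*-identityˡ y))) ⟩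
  y ^ℚ q ∎
  where
  open ℚₚ.≤-Reasoning
  γ = pos 1 /ℚ suc c
  mono : ∀ {a b} → a ≤ℚ b → ((γ ^ℚ q) *ℚ a) ≤ℚ ((γ ^ℚ q) *ℚ b)
  mono = ℚₚ.*-monoˡ-≤-nonNeg (γ ^ℚ q) {{^ℚ-nonNeg γ (/-nonNeg 1 (suc c)) q}}

-- For bounded `x` the constant alone absorbs the one surplus factor `x`.
power-bound-small : ∀ c q x A → NonNegativeℚ x → x ≤ℚ ι A → A ≤ suc c ^ q →
  ((pos 1 /ℚ suc c) ^ℚ q) *ℚ (x ^ℚ suc q) ≤ℚ (x ^ℚ q)
power-bound-small c q x A x≥0 x≤A A≤ = begin
  (γ ^ℚ q) *ℚ (x *ℚ x ^ℚ q) ≡⟨ ℚₚ.*-assoc (γ ^ℚ q) x _ ⟨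
  (γ ^ℚ q) *ℚ x *ℚ x ^ℚ q ≤⟨ ℚₚ.*-monoʳ-≤-nonNeg (x ^ℚ q) {{^ℚ-nonNeg x x≥0 q}}
     (ℚₚ.*-monoˡ-≤-nonNeg (γ ^ℚ q) {{^ℚ-nonNeg γ (/-nonNeg 1 (suc c)) q}} (ℚₚ.≤-trans x≤A (ι-mono A≤))) ⟩
  (γ ^ℚ q) *ℚ ι (suc c ^ q) *ℚ x ^ℚ q ≡⟨ cong (_*ℚ x ^ℚ q) (trans (cong ((γ ^ℚ q) *ℚ_) (≡-sym (ι-^ (suc c) q)))
     (trans (≡-sym (^ℚ-distrib-* γ (ι (suc c)) q)) (trans (cong (_^ℚ q) (inverse-ι c)) (1^ℚ q)))) ⟩
  1ℚ *ℚ x ^ℚ q ≡⟨ ℚₚ.*-identityˡ _ ⟩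
  x ^ℚ q ∎
  where
  open ℚₚ.≤-Reasoning
  γ = pos 1 /ℚ suc c

avgDeg-nonNeg : ∀ G → NonNegativeℚ (avgDeg G)
avgDeg-nonNeg G@record { n = zero } = _
avgDeg-nonNeg G@record { n = suc k } = /-nonNeg (degSum G) (suc k)

avgDeg-≤ : ∀ G A → 0 < n G → degSum G ≤ A * n G → avgDeg G ≤ℚ ι A
avgDeg-≤ G@record { n = suc k } A _ h = /-mono (degSum G) k A 0 (≤-trans (≤-reflexive (*-identityʳ _)) h)

≤-avgDeg : ∀ G B c → 0 < n G → B * n G ≤ c * degSum G → ι B ≤ℚ ι c *ℚ avgDeg G
≤-avgDeg G@record { n = suc k } B c _ h = subst (ι B ≤ℚ_) (≡-sym (/-* c 0 (degSum G) k))
  (/-mono B 0 (c * degSum G) (k + 0) (subst (_≤ c * degSum G * 1) (cong (λ v → B * suc v) (≡-sym (+-identityʳ k))) (≤-trans h (≤-reflexive (≡-sym (*-identityʳ _))))))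

-- Assembling the constants

-- Counts `m` upwards: when `m` grows by one, its integer `q`-th root grows by at most one.
root : ∀ q → 1 ≤ q → ∀ m → ∃ λ b → b ^ q ≤ m × m < suc b ^ q
root (suc q) _ zero = 0 , z≤n , ≤-reflexive (≡-sym (^-zeroˡ (suc q)))
root q 1≤q (suc m) with root q 1≤q m
... | b , low , high with suc b ^ q ≤? suc m
... | yes le = suc b , le , ≤-<-trans high (^-monoˡ-< q {{>-nonZero 1≤q}} (n<1+n (suc b)))
... | no gt = b , ≤-trans low (n≤1+n m) , ≰⇒> gt

minor-refl : ∀ G → IsMinor G G
minor-refl G = just , (λ u → u , refl) , (λ { u x y refl refl → here refl }) , λ u u′ a → u , u′ , refl , refl , a

-- Opaque, so that these large multiples are never unfolded into iterated sums.
opaque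
  scale : ℕ → ℕ
  scale s' = 8 * (256 * (2 * s'))

  scale-* : ∀ s' m → scale s' * m ≡ 8 * (256 * (2 * (s' * m)))
  scale-* s' m = trans (*-assoc 8 (256 * (2 * s')) m) (cong (8 *_) (trans (*-assoc 256 (2 * s') m) (cong (256 *_) (*-assoc 2 s' m))))

  s'≤scale : ∀ s' → s' ≤ scale s'
  s'≤scale s' = ≤-trans (m≤n*m s' 2) (≤-trans (m≤n*m _ 256) (m≤n*m _ 8))

  denominator : ℕ → ℕ
  denominator D = 16 * (D * D)

  denominator-def : ∀ D → denominator D ≡ 16 * (D * D)
  denominator-def D = refl

-- Small and large average degree

module Theorem (k s' : ℕ) (1≤k : 1 ≤ k) (k<s' : k < s') where

  -- `D * m` is eight times the host degree `d`, the constant of the theorem is the reciprocal of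
  -- `suc c`, and `q` is `2 * (s ∸ 1)`, the denominator in the exponent.
  D c q : ℕ
  D = scale s'
  c = denominator D
  q = 2 * k

  1≤s' : 1 ≤ s'
  1≤s' = ≤-trans (s≤s z≤n) k<s'

  1≤D : 1 ≤ D
  1≤D = ≤-trans 1≤s' (s'≤scale s')

  1≤q : 1 ≤ q
  1≤q = ≤-trans 1≤k (m≤m+n k _)

  x≤x^q : ∀ x → 1 ≤ x → x ≤ x ^ q
  x≤x^q x 1≤x = ≤-trans (≤-reflexive (≡-sym (^-identityʳ x))) (^-monoʳ-≤ x {{>-nonZero 1≤x}} 1≤q)

  -- The bound with exponent `1 + 1/q`, raised to the power `q` so that all exponents are natural
  -- numbers.
  Bounded : Graph → Graph → Set
  Bounded G Γ = ((pos 1 /ℚ suc c) ^ℚ q) *ℚ (avgDeg G ^ℚ suc q) ≤ℚ (avgDeg Γ ^ℚ q)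

  -- The average degree is at most `D * 16 ^ q`, which `suc c ^ q` exceeds, so `G` serves as its own
  -- minor.
  trivial-minor : ∀ G m → 0 < n G → degSum G ≤ D * n G * suc m → m < 16 ^ q → Bounded G G
  trivial-minor G m N>0 S≤ m<16^q = power-bound-small c q (avgDeg G) (D * 16 ^ q) (avgDeg-nonNeg G)
    (avgDeg-≤ G (D * 16 ^ q) N>0 (begin
      degSum G ≤⟨ S≤ ⟩
      D * n G * suc m ≤⟨ *-monoʳ-≤ (D * n G) m<16^q ⟩
      D * n G * 16 ^ q ≡⟨ swap D (n G) (16 ^ q) ⟩
      D * 16 ^ q * n G ∎))
    (begin
      D * 16 ^ q ≤⟨ *-monoˡ-≤ (16 ^ q) (x≤x^q D 1≤D) ⟩
      D ^ q * 16 ^ q ≡⟨ ^-distribʳ-* q D 16 ⟨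
      (D * 16) ^ q ≤⟨ ^-monoˡ-≤ q (≤-trans (≤-reflexive (*-comm D 16)) (≤-trans (*-monoʳ-≤ 16 (m≤n*m D D {{>-nonZero 1≤D}})) (≤-trans (≤-reflexive (≡-sym (denominator-def D))) (n≤1+n c)))) ⟩
      suc c ^ q ∎)
    where
    open ≤-Reasoning
    swap : ∀ a b e → a * b * e ≡ a * e * b
    swap = solve-∀

  -- `A` bounds the average degree of `G`. Since `m` is below `suc b ^ q`, hence at most
  -- `(2 * b) ^ q`, the extra factor `A` is at most `(2 * D * (2 * b)) ^ q`; this determines `B`.
  -- Clearing the constants against `b * m` leaves `16 * (D * D)`, the value of `c`.
  dense-bounded : ∀ G Γ m b → 0 < n G → 0 < n Γ → 1 ≤ m → 1 ≤ b → degSum G ≤ D * n G * suc m → m < suc b ^ q →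
    n Γ * (b * m) ≤ 2 * degSum Γ → Bounded G Γ
  dense-bounded G Γ m b N>0 N′>0 1≤m 1≤b S≤ m<b dense = power-bound c q (avgDeg G) (avgDeg Γ) A B (avgDeg-nonNeg G) (avgDeg-nonNeg Γ)
    (avgDeg-≤ G A N>0 (begin
      degSum G ≤⟨ S≤ ⟩
      D * n G * suc m ≤⟨ *-monoʳ-≤ (D * n G) (+-monoˡ-≤ m 1≤m) ⟩
      D * n G * (m + m) ≡⟨ regroup D (n G) m ⟩
      A * n G ∎))
    (begin
      A * A ^ q ≤⟨ *-monoˡ-≤ (A ^ q) (*-mono-≤ (x≤x^q (2 * D) (≤-trans 1≤D (m≤n*m D 2))) m≤) ⟩
      (2 * D) ^ q * (2 * b) ^ q * A ^ q ≡⟨ cong (_* A ^ q) (^-distribʳ-* q (2 * D) (2 * b)) ⟨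
      (2 * D * (2 * b)) ^ q * A ^ q ≡⟨ ^-distribʳ-* q (2 * D * (2 * b)) A ⟨
      B ^ q ∎)
    (≤-avgDeg Γ B (suc c) N′>0 (begin
      B * n Γ ≡⟨ regroup′ D b m (n Γ) ⟩
      8 * (D * D) * (n Γ * (b * m)) ≤⟨ *-monoʳ-≤ (8 * (D * D)) dense ⟩
      8 * (D * D) * (2 * degSum Γ) ≡⟨ trans (regroup″ D (degSum Γ)) (cong (_* degSum Γ) (≡-sym (denominator-def D))) ⟩
      c * degSum Γ ≤⟨ *-monoˡ-≤ (degSum Γ) (n≤1+n c) ⟩
      suc c * degSum Γ ∎))
    where
    open ≤-Reasoning
    A B : ℕ
    A = 2 * D * m
    B = 2 * D * (2 * b) * A
    m≤ : m ≤ (2 * b) ^ q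
    m≤ = ≤-trans (<⇒≤ m<b) (^-monoˡ-≤ q (≤-trans (+-monoˡ-≤ b 1≤b) (+-monoʳ-≤ b (m≤m+n b 0))))
    regroup : ∀ D N m → D * N * (m + m) ≡ 2 * D * m * N
    regroup = solve-∀
    regroup′ : ∀ D b m N → 2 * D * (2 * b) * (2 * D * m) * N ≡ 8 * (D * D) * (N * (b * m))
    regroup′ = solve-∀
    regroup″ : ∀ D S → 8 * (D * D) * (2 * S) ≡ 16 * (D * D) * S
    regroup″ = solve-∀

  bounded-minor : ∀ G → 0 < n G → KFree (suc k) s' G → Σ Graph λ Γ → 0 < n Γ × IsMinor Γ G × Bounded G Γ
  bounded-minor G N>0 free with root q 1≤q m₀
    where
    -- The average degree divided by `D`, rounded down; its integer `q`-th root is `b`.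
    m₀ = _/_ (degSum G) (D * n G) {{>-nonZero (*-mono-≤ 1≤D N>0)}}
  ... | b , low , high = go (16 ≤? b)
    where
    open ≤-Reasoning
    instance
      DN≢0 : NonZero (D * n G)
      DN≢0 = >-nonZero (*-mono-≤ 1≤D N>0)
    m : ℕ
    m = degSum G / (D * n G)
    S≤ : degSum G ≤ D * n G * suc m
    S≤ = begin
      degSum G ≡⟨ m≡m%n+[m/n]*n (degSum G) (D * n G) ⟩
      degSum G % (D * n G) + m * (D * n G) ≤⟨ +-monoˡ-≤ _ (<⇒≤ (m%n<n (degSum G) (D * n G))) ⟩
      suc m * (D * n G) ≡⟨ *-comm (suc m) (D * n G) ⟩
      D * n G * suc m ∎
    go : _ → Σ Graph λ Γ → 0 < n Γ × IsMinor Γ G × Bounded G Γ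
    go (no ¬16≤b) = G , N>0 , minor-refl G , trivial-minor G m N>0 S≤ (<-≤-trans high (^-monoˡ-≤ q (≰⇒> ¬16≤b)))
    go (yes 16≤b) = let Γ , N′>0 , minor , dense = Bagging.dense-minor G k s' m b (2 * (s' * m)) d free 1≤k k<s' 16≤b b²ᵏ≤m refl refl H in
      Γ , N′>0 , minor , dense-bounded G Γ m b N>0 N′>0 1≤m 1≤b S≤ high dense
      where
      1≤b : 1 ≤ b
      1≤b = ≤-trans (s≤s z≤n) 16≤b
      1≤m : 1 ≤ m
      1≤m = ≤-trans 1≤b (≤-trans (x≤x^q b 1≤b) low)
      b²ᵏ≤m : b ^ k * b ^ k ≤ m
      b²ᵏ≤m = subst (_≤ m) (trans (^-distribˡ-+-* b k (k + 0)) (cong (λ v → b ^ k * b ^ v) (+-identityʳ k))) low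
      d : ℕ
      d = 256 * (2 * (s' * m))
      0<d : 0 < d
      0<d = ≤-trans (*-mono-≤ 1≤s' 1≤m) (≤-trans (m≤n*m (s' * m) 2) (m≤n*m _ 256))
      H : Host G d
      H = host G d (begin-strict
        -- The 8 built into `scale`, against the 4 that `host` asks for, makes the inequality
        -- strict.
        4 * (d * n G) <⟨ *-monoˡ-< (d * n G) {{>-nonZero (*-mono-≤ 0<d N>0)}} (s≤s (s≤s (s≤s (s≤s (s≤s (z≤n {3})))))) ⟩
        8 * (d * n G) ≡⟨ *-assoc 8 d (n G) ⟨
        8 * d * n G ≡⟨ cong (_* n G) (trans (≡-sym (scale-* s' m)) (*-comm D m)) ⟩
        m * D * n G ≡⟨ *-assoc m D (n G) ⟩
        m * (D * n G) ≤⟨ m/n*n≤m (degSum G) (D * n G) ⟩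
        degSum G ≡⟨ degSum-# G ⟩
        sum (λ i → # adj G i) ∎)

theorem4p5 : (s s' : ℕ) → 2 ≤ s → s ≤ s' →
    Σ ℚ λ c → (0ℚ <ℚ c) ×
    ((G : Graph) → 1 ≤ n G → KFree s s' G →
    Σ Graph λ Γ → (1 ≤ n Γ) × IsMinor Γ G ×
    ((c ^ℚ (2 * (s ∸ 1))) *ℚ (avgDeg G ^ℚ (2 * s ∸ 1))
    ≤ℚ (avgDeg Γ ^ℚ (2 * (s ∸ 1)))))
theorem4p5 (suc k) s' (s≤s 1≤k) k<s' = γ , ℚₚ.positive⁻¹ γ {{ℚₚ.normalize-pos 1 (suc c)}} , λ G N>0 free →
  let Γ , N′>0 , minor , bounded = bounded-minor G N>0 free
  -- For `s = suc k` the exponent `2 * s ∸ 1` computes to `k + suc (k + 0)`, which must be rewritten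
  -- as `suc q`.
  in Γ , N′>0 , minor , subst (λ e → (γ ^ℚ q) *ℚ (avgDeg G ^ℚ e) ≤ℚ (avgDeg Γ ^ℚ q)) (≡-sym (+-suc k (k + 0))) bounded
  where
  open Theorem k s' 1≤k k<s'
  γ : ℚ
  γ = pos 1 /ℚ suc c
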